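{- Let $\mathcal{E},\mathcal{F},\mathcal{G}$ be bundle event structures with internal probability (ipBES) over a finite state space $\Omega$. Then \begin{align*} \mathcal{E}\|\mathcal{F}&\equiv_{\mathrm{sim}}\mathcal{F}\|\mathcal{E},\\ \mathcal{E}\|(\mathcal{F}\|\mathcal{G})&\equiv_{\mathrm{sim}}(\mathcal{E}\|\mathcal{F})\|\mathcal{G},\\ \mathcal{E}*\mathcal{F}&\equiv_{\mathrm{sim}}\mathcal{F}+\mathcal{E}\cdot(\mathcal{E}*\mathcal{F}),\\ \mathcal{E}\sqsubseteq_{\mathrm{sim}}\mathcal{F}&\Rightarrow\mathcal{G}+\mathcal{E}\sqsubseteq_{\mathrm{sim}}\mathcal{G}+\mathcal{F},\\ \mathcal{E}\sqsubseteq_{\mathrm{sim}}\mathcal{F}&\Rightarrow\mathcal{G}\cdot\mathcal{E}\sqsubseteq_{\mathrm{sim}}\mathcal{G}\cdot\mathcal{F},\\ \mathcal{E}\sqsubseteq_{\mathrm{sim}}\mathcal{F}&\Rightarrow\mathcal{E}\|\mathcal{G}\sqsubseteq_{\mathrm{sim}}\mathcal{F}\|\mathcal{G}. \end{align*}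
   Context: **Programs.** $\Omega$ is a fixed finite set of states. $\mathbb{D}\Omega$ is the set of distributions on $\Omega$, viewed inside $\mathbb{R}^\Omega$; $\delta_s$ is the point distribution at $s$. $\mathbb{H}_1\Omega$ is the set of maps $r:\Omega\to\mathcal{P}(\mathbb{D}\Omega)$ such that each $r(s)$ is non-empty, convex and topologically closed. A test is a map $b:\Omega\to\mathcal{P}(\mathbb{D}\Omega)$ with $b(s)\subseteq\{\delta_s\}$. $\overline{\mathbb{H}}_1\Omega$ is $\mathbb{H}_1\Omega$ together with all tests, ordered by $r\sqsubseteq_{\mathbb{H}}r'$ iff $r(s)\subseteq r'(s)$ for all $s$. $\delta$ denotes the program $\delta(s)=\{\delta_s\}$. **ipBES.** An ipBES is $\mathcal{E}=(E,\mapsto,\#,\lambda,\mathbf{\Phi})$ where $E$ is a set of events; $\#$ is an irreflexive symmetric relation on $E$; for $x,x'\subseteq E$, $x\#x'$ means $e\#e'$ for all $e\in x,e'\in x'$ with $e\ne e'$; $\mapsto\subseteq\mathcal{P}(E)\times E$ satisfies $x\#x$ whenever $x\mapsto e$; $\lambda:E\to\overline{\mathbb{H}}_1\Omega$; $\mathbf{\Phi}\subseteq\mathcal{P}(E)$ with $x\#x$ for $x\in\mathbf{\Phi}$. $\mathbf{in}(\mathcal{E})$ is the set of initial events, i.e. events $e$ with no bundle $x\mapsto e$. **Traces.** A finite trace is a finite sequence $e_1\cdots e_n$ of distinct, pairwise non-conflicting events such that for every $j$ and every bundle $x\mapsto e_j$ there is $i<j$ with $e_i\in x$. $\mathcal{T}(\mathcal{E})$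 is the set of finite traces (empty trace $\emptyset$), $\mathcal{T}_{\max}(\mathcal{E})$ the set of prefix-maximal ones. A trace $\alpha$ is weakly maximal if it is maximal or there are events $e_1,\dots,e_n$ with $\alpha e_1\cdots e_n\in\mathcal{T}_{\max}(\mathcal{E})$ and $\delta\sqsubseteq_{\mathbb{H}}\lambda(e_i)$ for all $i$. **t-simulation.** A function $f:\mathcal{T}(\mathcal{E})\to\mathcal{T}(\mathcal{F})$ is a t-simulation if: (i) $f(\emptyset)=\emptyset$ and $f^{ -1}(\beta)$ is finite for every $\beta\in\mathcal{T}(\mathcal{F})$; (ii) if $\alpha e\in\mathcal{T}(\mathcal{E})$ then either $f(\alpha e)=f(\alpha)$ and $\lambda(e)\sqsubseteq_{\mathbb{H}}\delta$, or there is an event $e'$ of $\mathcal{F}$ with $\lambda(e)\sqsubseteq_{\mathbb{H}}\lambda(e')$ and $f(\alpha e)=f(\alpha)e'$; (iii) if $\alpha e$ is maximal in $\mathcal{T}(\mathcal{E})$ then $f(\alpha e)=f(\alpha)e'$ for some $e'$ with $\lambda(e)\sqsubseteq_{\mathbb{H}}\lambda(e')$, and $f(\alpha e)$ is weakly maximal in $\mathcal{T}(\mathcal{F})$. $\mathcal{E}\sqsubseteq_{\mathrm{sim}}\mathcal{F}$ means there is a t-simulation from $\mathcal{E}$ to $\mathcal{F}$; $\mathcal{E}\equiv_{\mathrm{sim}}\mathcal{F}$ means $\mathcal{E}\sqsubseteq_{\mathrm{sim}}\mathcal{F}$ and $\mathcal{F}\sqsubseteq_{\mathrm{sim}}\mathcal{E}$.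 **Operations on ipBES** (event sets of the operands are taken disjoint, renaming events, i.e. using fresh copies, if necessary). - $0$ is the structure with no events and $\mathbf{\Phi}=\emptyset$; by convention $0+\mathcal{E}=\mathcal{E}+0=\mathcal{E}$ and $0\cdot\mathcal{E}=\mathcal{E}\cdot0=\mathcal{E}$. - $\mathcal{E}+\mathcal{F}$ has events $E\cup F$, bundles $\mapsto_{\mathcal{E}}\cup\mapsto_{\mathcal{F}}$, labels $\lambda_{\mathcal{E}}\cup\lambda_{\mathcal{F}}$, exit sets $\{x\cup y: x\in\mathbf{\Phi}_{\mathcal{E}},y\in\mathbf{\Phi}_{\mathcal{F}}\}$, and conflict $\#_{\mathcal{E}}\cup\#_{\mathcal{F}}$ together with the symmetric closure of $\mathbf{in}(\mathcal{E})\times\mathbf{in}(\mathcal{F})$ and of all $x\times y$ with $x\in\mathbf{\Phi}_{\mathcal{E}}$, $y\in\mathbf{\Phi}_{\mathcal{F}}$. - $\mathcal{E}\cdot\mathcal{F}$ has events $E\cup F$, conflict $\#_{\mathcal{E}}\cup\#_{\mathcal{F}}$, bundles $\mapsto_{\mathcal{E}}\cup\mapsto_{\mathcal{F}}\cup\{x\mapsto e: x\in\mathbf{\Phi}_{\mathcal{E}},e\in\mathbf{in}(\mathcal{F})\}$, labels $\lambda_{\mathcal{E}}\cup\lambda_{\mathcal{F}}$, exit sets $\mathbf{\Phi}_{\mathcal{F}}$. - $\mathcal{E}\|\mathcal{F}=(E\cup F,\ \mapsto_{\mathcal{E}}\cup\mapsto_{\mathcal{F}},\ \#_{\mathcal{E}}\cup\#_{\mathcal{F}},\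 \lambda_{\mathcal{E}}\cup\lambda_{\mathcal{F}},\ \mathbf{\Phi}_{\mathcal{E}}\cup\mathbf{\Phi}_{\mathcal{F}})$. - $\mathcal{E}*\mathcal{F}$ (binary Kleene star) is the supremum (limit) of the increasing sequence $\mathcal{F},\ \mathcal{F}+\mathcal{E}\cdot\mathcal{F},\ \mathcal{F}+\mathcal{E}\cdot(\mathcal{F}+\mathcal{E}\cdot\mathcal{F}),\dots$. Explicitly, for $\mathcal{E}\ne0$, take disjoint copies $\mathcal{E}_k,\mathcal{F}_k$ ($k\ge0$); the events are those of all copies with their labels; the bundles are those of the copies plus $x\mapsto e$ for $x\in\mathbf{\Phi}_{\mathcal{E}_k}$, $e\in\mathbf{in}(\mathcal{F}_{k+1})\cup\mathbf{in}(\mathcal{E}_{k+1})$; the conflicts are those of the copies plus the symmetric closure of $\mathbf{in}(\mathcal{F}_k)\times\mathbf{in}(\mathcal{E}_k)$ and of $x\times y$ for $x\in\mathbf{\Phi}_{\mathcal{F}_k},y\in\mathbf{\Phi}_{\mathcal{F}_j}$, $j\ne k$; the exit sets are the unions $\bigcup_k x_k$ with $x_k\in\mathbf{\Phi}_{\mathcal{F}_k}$. If $\mathcal{E}=0$ then $\mathcal{E}*\mathcal{F}=\mathcal{F}$.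
   Formalization: The last two implications (for · and ∥) also assume: if the empty trace is maximal in E, it is weakly maximal in F; they fail for E=0 otherwise. If E≠0 has no exit sets, E*F is the limit of the sequence, not the explicit description, which breaks the star law there. -}

module Defs where

open import Axiom.ExcludedMiddle using (ExcludedMiddle)
open import Data.Bool using (true; false; if_then_else_)
open import Data.Empty using (⊥-elim)
open import Data.Fin using (Fin; zero; suc)
import Data.Fin as Fin
open import Data.List using (List; []; _∷_; _++_; _∷ʳ_)
open import Data.List.Membership.Propositional using () renaming (_∈_ to _∈ˡ_)
open import Data.List.Relation.Unary.All using (All)
open import Data.List.Relation.Unary.AllPairs using (AllPairs)
open import Data.List.Relation.Unary.Any using (Any)
open import Data.List.Relation.Unary.Unique.Propositional using (Unique)
open import Data.Nat using (ℕ; zero; suc) renaming (_≤_ to _≤ⁿ_; _<_ to _<ⁿ_; _⊔_ to _⊔ⁿ_)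
import Data.Nat.Properties as ℕₚ
open import Data.Product using (Σ; ∃; ∃-syntax; _×_; _,_; proj₁; proj₂)
open import Data.Rational using (ℚ; 0ℚ; 1ℚ; ½)
import Data.Rational as ℚ
import Data.Rational.Properties as ℚₚ
open import Data.Rational.Solver using (module +-*-Solver)
open import Data.Sum using (_⊎_; inj₁; inj₂)
open import Data.Sum.Relation.Binary.Pointwise using (Pointwise; inj₁; inj₂)
import Data.Vec.Functional as Vector
open import Level using (Level; 0ℓ)
import Level
open import Relation.Binary.Definitions using (Irreflexive; Symmetric; _Respects_)
open import Relation.Binary.PropositionalEquality
  using (_≡_; _≢_; refl; sym; trans; cong; cong₂; subst; subst₂)
open import Relation.Nullary using (¬_; yes; no; does)
open import Relation.Unary using (Pred; _∈_; _⊆_; ∅; Empty; Satisfiable; _⟨⊎⟩_)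

1ℓ : Level
1ℓ = Level.suc 0ℓ

------------------------------------------------------------------------
-- Real numbers, as Cauchy sequences of rationals with setoid equality _≈_

record ℝ : Set where
  field
    seq    : ℕ → ℚ
    cauchy : ∀ ε → 0ℚ ℚ.< ε →
             ∃[ N ] ∀ m n → N ≤ⁿ m → N ≤ⁿ n → ℚ.∣ seq m ℚ.- seq n ∣ ℚ.≤ ε

open ℝ public

infix 4 _≤_ _≈_

_≤_ : ℝ → ℝ → Set
x ≤ y = ∀ ε → 0ℚ ℚ.< ε → ∃[ N ] ∀ n → N ≤ⁿ n → seq x n ℚ.≤ seq y n ℚ.+ ε

_≈_ : ℝ → ℝ → Set
x ≈ y = x ≤ y × y ≤ x

private
  half>0 : ∀ {ε} → 0ℚ ℚ.< ε → 0ℚ ℚ.< ε ℚ.* ½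
  half>0 {ε} 0<ε = subst (ℚ._< ε ℚ.* ½) (ℚₚ.*-zeroˡ ½) (ℚₚ.*-monoˡ-<-pos ½ 0<ε)

  halves : ∀ ε → ε ℚ.* ½ ℚ.+ ε ℚ.* ½ ≡ ε
  halves ε = trans (sym (ℚₚ.*-distribˡ-+ ε ½ ½)) (ℚₚ.*-identityʳ ε)

  shuffle-+ : ∀ a b c d → (a ℚ.+ b) ℚ.- (c ℚ.+ d) ≡ (a ℚ.- c) ℚ.+ (b ℚ.- d)
  shuffle-+ = solve 4 (λ a b c d → (a :+ b) :- (c :+ d) := (a :- c) :+ (b :- d)) refl
    where open +-*-Solver

  shuffle-* : ∀ a b c d → (a ℚ.* b) ℚ.- (c ℚ.* d) ≡ a ℚ.* (b ℚ.- d) ℚ.+ d ℚ.* (a ℚ.- c)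
  shuffle-* = solve 4 (λ a b c d →
      (a :* b) :- (c :* d) := a :* (b :- d) :+ d :* (a :- c)) refl
    where open +-*-Solver

  split : ∀ a b → a ≡ b ℚ.+ (a ℚ.- b)
  split = solve 2 (λ a b → a := b :+ (a :- b)) refl
    where open +-*-Solver

  -- every Cauchy sequence is eventually bounded
  bounded : ∀ x → ∃[ K ] 0ℚ ℚ.< K × ∃[ N ] (∀ n → N ≤ⁿ n → ℚ.∣ seq x n ∣ ℚ.≤ K)
  bounded x with cauchy x 1ℚ (ℚₚ.positive⁻¹ 1ℚ)
  ... | N , close = ℚ.∣ seq x N ∣ ℚ.+ 1ℚ , K>0 , N , bound
    where
    open ℚₚ.≤-Reasoning
    K>0 : 0ℚ ℚ.< ℚ.∣ seq x N ∣ ℚ.+ 1ℚ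
    K>0 = subst (ℚ._< ℚ.∣ seq x N ∣ ℚ.+ 1ℚ) (ℚₚ.+-identityʳ 0ℚ)
            (ℚₚ.+-mono-≤-< (ℚₚ.0≤∣p∣ (seq x N)) (ℚₚ.positive⁻¹ 1ℚ))
    bound : ∀ n → N ≤ⁿ n → ℚ.∣ seq x n ∣ ℚ.≤ ℚ.∣ seq x N ∣ ℚ.+ 1ℚ
    bound n N≤n = begin
      ℚ.∣ seq x n ∣                                   ≡⟨ cong ℚ.∣_∣ (split (seq x n) (seq x N)) ⟩
      ℚ.∣ seq x N ℚ.+ (seq x n ℚ.- seq x N) ∣         ≤⟨ ℚₚ.∣p+q∣≤∣p∣+∣q∣ (seq x N) _ ⟩
      ℚ.∣ seq x N ∣ ℚ.+ ℚ.∣ seq x n ℚ.- seq x N ∣     ≤⟨ ℚₚ.+-monoʳ-≤ ℚ.∣ seq x N ∣ (close n N N≤n ℕₚ.≤-refl) ⟩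
      ℚ.∣ seq x N ∣ ℚ.+ 1ℚ                            ∎

  -- a rational δ > 0 with K * δ ≡ ε
  divide : ∀ K ε → 0ℚ ℚ.< K → 0ℚ ℚ.< ε → ∃[ δ ] 0ℚ ℚ.< δ × K ℚ.* δ ≡ ε
  divide K ε 0<K 0<ε = ℚ.1/ K ℚ.* ε , δ>0 , eq
    where
    instance
      posK : ℚ.Positive K
      posK = ℚ.positive 0<K
      nzK : ℚ.NonZero K
      nzK = ℚₚ.pos⇒nonZero K
      pos1/K : ℚ.Positive (ℚ.1/ K)
      pos1/K = ℚₚ.1/pos⇒pos K
    δ>0 : 0ℚ ℚ.< ℚ.1/ K ℚ.* ε
    δ>0 = subst (ℚ._< ℚ.1/ K ℚ.* ε) (ℚₚ.*-zeroʳ (ℚ.1/ K)) (ℚₚ.*-monoʳ-<-pos (ℚ.1/ K) 0<ε)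
    eq : K ℚ.* (ℚ.1/ K ℚ.* ε) ≡ ε
    eq = trans (sym (ℚₚ.*-assoc K (ℚ.1/ K) ε))
           (trans (cong (ℚ._* ε) (ℚₚ.*-inverseʳ K)) (ℚₚ.*-identityˡ ε))

  ∣*∣-bound : ∀ a b {K δ} → 0ℚ ℚ.< K → ℚ.∣ a ∣ ℚ.≤ K → ℚ.∣ b ∣ ℚ.≤ δ →
              ℚ.∣ a ℚ.* b ∣ ℚ.≤ K ℚ.* δ
  ∣*∣-bound a b {K} {δ} 0<K ∣a∣≤K ∣b∣≤δ = begin
    ℚ.∣ a ℚ.* b ∣           ≡⟨ ℚₚ.∣p*q∣≡∣p∣*∣q∣ a b ⟩
    ℚ.∣ a ∣ ℚ.* ℚ.∣ b ∣     ≤⟨ ℚₚ.*-monoʳ-≤-nonNeg ℚ.∣ b ∣ {{ℚₚ.∣-∣-nonNeg b}} ∣a∣≤K ⟩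
    K ℚ.* ℚ.∣ b ∣           ≤⟨ ℚₚ.*-monoˡ-≤-nonNeg K {{ℚₚ.pos⇒nonNeg K {{ℚ.positive 0<K}}}} ∣b∣≤δ ⟩
    K ℚ.* δ                 ∎
    where open ℚₚ.≤-Reasoning

  product-cauchy : ∀ x y ε → 0ℚ ℚ.< ε →
    ∃[ N ] ∀ m n → N ≤ⁿ m → N ≤ⁿ n →
      ℚ.∣ (seq x m ℚ.* seq y m) ℚ.- (seq x n ℚ.* seq y n) ∣ ℚ.≤ ε
  product-cauchy x y ε 0<ε =
    let K , 0<K , A , boundˣ = bounded x
        L , 0<L , B , boundʸ = bounded y
        δ , 0<δ , Kδ≡        = divide K (ε ℚ.* ½) 0<K (half>0 0<ε)
        γ , 0<γ , Lγ≡        = divide L (ε ℚ.* ½) 0<L (half>0 0<ε)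
        N , closeʸ           = cauchy y δ 0<δ
        M , closeˣ           = cauchy x γ 0<γ
    in combine K L δ γ A B N M 0<K 0<L boundˣ boundʸ Kδ≡ Lγ≡ closeʸ closeˣ
    where
    combine : ∀ K L δ γ A B N M → 0ℚ ℚ.< K → 0ℚ ℚ.< L →
      (∀ n → A ≤ⁿ n → ℚ.∣ seq x n ∣ ℚ.≤ K) → (∀ n → B ≤ⁿ n → ℚ.∣ seq y n ∣ ℚ.≤ L) →
      K ℚ.* δ ≡ ε ℚ.* ½ → L ℚ.* γ ≡ ε ℚ.* ½ →
      (∀ m n → N ≤ⁿ m → N ≤ⁿ n → ℚ.∣ seq y m ℚ.- seq y n ∣ ℚ.≤ δ) →
      (∀ m n → M ≤ⁿ m → M ≤ⁿ n → ℚ.∣ seq x m ℚ.- seq x n ∣ ℚ.≤ γ) →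
      ∃[ N ] ∀ m n → N ≤ⁿ m → N ≤ⁿ n →
        ℚ.∣ (seq x m ℚ.* seq y m) ℚ.- (seq x n ℚ.* seq y n) ∣ ℚ.≤ ε
    combine K L δ γ A B N M 0<K 0<L boundˣ boundʸ Kδ≡ Lγ≡ closeʸ closeˣ =
      (A ⊔ⁿ B) ⊔ⁿ (N ⊔ⁿ M) , close
      where
      open ℚₚ.≤-Reasoning
      A≤ : ∀ {k} → (A ⊔ⁿ B) ⊔ⁿ (N ⊔ⁿ M) ≤ⁿ k → A ≤ⁿ k
      A≤ h = ℕₚ.m⊔n≤o⇒m≤o A B (ℕₚ.m⊔n≤o⇒m≤o (A ⊔ⁿ B) (N ⊔ⁿ M) h)
      B≤ : ∀ {k} → (A ⊔ⁿ B) ⊔ⁿ (N ⊔ⁿ M) ≤ⁿ k → B ≤ⁿ k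
      B≤ h = ℕₚ.m⊔n≤o⇒n≤o A B (ℕₚ.m⊔n≤o⇒m≤o (A ⊔ⁿ B) (N ⊔ⁿ M) h)
      N≤ : ∀ {k} → (A ⊔ⁿ B) ⊔ⁿ (N ⊔ⁿ M) ≤ⁿ k → N ≤ⁿ k
      N≤ h = ℕₚ.m⊔n≤o⇒m≤o N M (ℕₚ.m⊔n≤o⇒n≤o (A ⊔ⁿ B) (N ⊔ⁿ M) h)
      M≤ : ∀ {k} → (A ⊔ⁿ B) ⊔ⁿ (N ⊔ⁿ M) ≤ⁿ k → M ≤ⁿ k
      M≤ h = ℕₚ.m⊔n≤o⇒n≤o N M (ℕₚ.m⊔n≤o⇒n≤o (A ⊔ⁿ B) (N ⊔ⁿ M) h)
      close : ∀ m n → (A ⊔ⁿ B) ⊔ⁿ (N ⊔ⁿ M) ≤ⁿ m → (A ⊔ⁿ B) ⊔ⁿ (N ⊔ⁿ M) ≤ⁿ n →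
              ℚ.∣ (seq x m ℚ.* seq y m) ℚ.- (seq x n ℚ.* seq y n) ∣ ℚ.≤ ε
      close m n ≤m ≤n = begin
        ℚ.∣ (seq x m ℚ.* seq y m) ℚ.- (seq x n ℚ.* seq y n) ∣
          ≡⟨ cong ℚ.∣_∣ (shuffle-* (seq x m) (seq y m) (seq x n) (seq y n)) ⟩
        ℚ.∣ seq x m ℚ.* (seq y m ℚ.- seq y n) ℚ.+ seq y n ℚ.* (seq x m ℚ.- seq x n) ∣
          ≤⟨ ℚₚ.∣p+q∣≤∣p∣+∣q∣ (seq x m ℚ.* (seq y m ℚ.- seq y n)) (seq y n ℚ.* (seq x m ℚ.- seq x n)) ⟩
        ℚ.∣ seq x m ℚ.* (seq y m ℚ.- seq y n) ∣ ℚ.+ ℚ.∣ seq y n ℚ.* (seq x m ℚ.- seq x n) ∣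
          ≤⟨ ℚₚ.+-mono-≤
               (∣*∣-bound (seq x m) (seq y m ℚ.- seq y n) 0<K
                  (boundˣ m (A≤ ≤m)) (closeʸ m n (N≤ ≤m) (N≤ ≤n)))
               (∣*∣-bound (seq y n) (seq x m ℚ.- seq x n) 0<L
                  (boundʸ n (B≤ ≤n)) (closeˣ m n (M≤ ≤m) (M≤ ≤n))) ⟩
        K ℚ.* δ ℚ.+ L ℚ.* γ
          ≡⟨ cong₂ ℚ._+_ Kδ≡ Lγ≡ ⟩
        ε ℚ.* ½ ℚ.+ ε ℚ.* ½
          ≡⟨ halves ε ⟩
        ε ∎

infixl 6 _+ᴿ_
infixl 7 _*ᴿ_

constᴿ : ℚ → ℝ
constᴿ q .seq _ = q
constᴿ q .cauchy ε 0<ε = 0 , λ _ _ _ _ →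
  subst (ℚ._≤ ε) (sym (cong ℚ.∣_∣ (ℚₚ.+-inverseʳ q))) (ℚₚ.<⇒≤ 0<ε)

0ᴿ 1ᴿ : ℝ
0ᴿ = constᴿ 0ℚ
1ᴿ = constᴿ 1ℚ

_+ᴿ_ : ℝ → ℝ → ℝ
(x +ᴿ y) .seq n = seq x n ℚ.+ seq y n
(x +ᴿ y) .cauchy ε 0<ε with cauchy x _ (half>0 0<ε) | cauchy y _ (half>0 0<ε)
... | N , closeˣ | M , closeʸ = N ⊔ⁿ M , close
  where
  open ℚₚ.≤-Reasoning
  close : ∀ m n → N ⊔ⁿ M ≤ⁿ m → N ⊔ⁿ M ≤ⁿ n →
          ℚ.∣ (seq x m ℚ.+ seq y m) ℚ.- (seq x n ℚ.+ seq y n) ∣ ℚ.≤ ε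
  close m n ≤m ≤n = begin
    ℚ.∣ (seq x m ℚ.+ seq y m) ℚ.- (seq x n ℚ.+ seq y n) ∣
      ≡⟨ cong ℚ.∣_∣ (shuffle-+ (seq x m) (seq y m) (seq x n) (seq y n)) ⟩
    ℚ.∣ (seq x m ℚ.- seq x n) ℚ.+ (seq y m ℚ.- seq y n) ∣
      ≤⟨ ℚₚ.∣p+q∣≤∣p∣+∣q∣ (seq x m ℚ.- seq x n) _ ⟩
    ℚ.∣ seq x m ℚ.- seq x n ∣ ℚ.+ ℚ.∣ seq y m ℚ.- seq y n ∣
      ≤⟨ ℚₚ.+-mono-≤ (closeˣ m n (ℕₚ.m⊔n≤o⇒m≤o N M ≤m) (ℕₚ.m⊔n≤o⇒m≤o N M ≤n))
                     (closeʸ m n (ℕₚ.m⊔n≤o⇒n≤o N M ≤m) (ℕₚ.m⊔n≤o⇒n≤o N M ≤n)) ⟩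
    ε ℚ.* ½ ℚ.+ ε ℚ.* ½
      ≡⟨ halves ε ⟩
    ε ∎

_*ᴿ_ : ℝ → ℝ → ℝ
(x *ᴿ y) .seq n = seq x n ℚ.* seq y n
(x *ᴿ y) .cauchy = product-cauchy x y

≤-reflexive : ∀ {x y} → (∀ n → seq x n ≡ seq y n) → x ≤ y
≤-reflexive {x} {y} eq ε 0<ε = 0 , λ n _ →
  subst₂ ℚ._≤_ (trans (ℚₚ.+-identityʳ _) (sym (eq n))) refl
    (ℚₚ.+-monoʳ-≤ (seq y n) (ℚₚ.<⇒≤ 0<ε))

≤-trans : ∀ {x y z} → x ≤ y → y ≤ z → x ≤ z
≤-trans {x} {y} {z} x≤y y≤z ε 0<ε with x≤y _ (half>0 0<ε) | y≤z _ (half>0 0<ε)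
... | N , p | M , q = N ⊔ⁿ M , λ n ≤n → begin
    seq x n                                  ≤⟨ p n (ℕₚ.m⊔n≤o⇒m≤o N M ≤n) ⟩
    seq y n ℚ.+ ε ℚ.* ½                      ≤⟨ ℚₚ.+-monoˡ-≤ (ε ℚ.* ½) (q n (ℕₚ.m⊔n≤o⇒n≤o N M ≤n)) ⟩
    seq z n ℚ.+ ε ℚ.* ½ ℚ.+ ε ℚ.* ½          ≡⟨ ℚₚ.+-assoc (seq z n) _ _ ⟩
    seq z n ℚ.+ (ε ℚ.* ½ ℚ.+ ε ℚ.* ½)        ≡⟨ cong (seq z n ℚ.+_) (halves ε) ⟩
    seq z n ℚ.+ ε                            ∎
  where open ℚₚ.≤-Reasoning

≈-sym : ∀ {x y} → x ≈ y → y ≈ x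
≈-sym (p , q) = q , p

≈-trans : ∀ {x y z} → x ≈ y → y ≈ z → x ≈ z
≈-trans {x} {y} {z} (p , p′) (q , q′) =
  ≤-trans {x} {y} {z} p q , ≤-trans {z} {y} {x} q′ p′

------------------------------------------------------------------------
-- Distributions over the state space Ω = Fin n

sumᴿ : ∀ {n} → (Fin n → ℝ) → ℝ
sumᴿ = Vector.foldr _+ᴿ_ 0ᴿ

record 𝔻 (n : ℕ) : Set where
  field
    mass   : Fin n → ℝ
    nonneg : ∀ s → 0ᴿ ≤ mass s
    total  : sumᴿ mass ≈ 1ᴿ

open 𝔻 public

infix 4 _≈ᴰ_

_≈ᴰ_ : ∀ {n} → 𝔻 n → 𝔻 n → Set
p ≈ᴰ q = ∀ s → mass p s ≈ mass q s

indicator : ∀ {n} → Fin n → Fin n → ℝ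
indicator s t = if does (s Fin.≟ t) then 1ᴿ else 0ᴿ

private
  sum-zero : ∀ n k → seq (sumᴿ {n} (λ _ → 0ᴿ)) k ≡ 0ℚ
  sum-zero zero    k = refl
  sum-zero (suc n) k = trans (ℚₚ.+-identityˡ _) (sum-zero n k)

  sum-indicator : ∀ {n} (s : Fin n) k → seq (sumᴿ (indicator s)) k ≡ 1ℚ
  sum-indicator {suc n} zero    k = cong (1ℚ ℚ.+_) (sum-zero n k)
  sum-indicator {suc n} (suc s) k = trans (ℚₚ.+-identityˡ _) (sum-indicator s k)

point : ∀ {n} → Fin n → 𝔻 n
point s .mass = indicator s
point s .nonneg t with does (s Fin.≟ t)
... | true  = λ ε 0<ε → 0 , λ _ _ →
  ℚₚ.<⇒≤ (ℚₚ.+-mono-< (ℚₚ.positive⁻¹ 1ℚ) 0<ε)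
... | false = ≤-reflexive {0ᴿ} {0ᴿ} (λ _ → refl)
point s .total =
  ≤-reflexive {sumᴿ (indicator s)} {1ᴿ} (sum-indicator s) ,
  ≤-reflexive {1ᴿ} {sumᴿ (indicator s)} (λ k → sym (sum-indicator s k))

Convex : ∀ {n} → Pred (𝔻 n) 0ℓ → Set
Convex X = ∀ p q → p ∈ X → q ∈ X →
           ∀ a b → 0ᴿ ≤ a → 0ᴿ ≤ b → a +ᴿ b ≈ 1ᴿ →
           ∀ r → (∀ s → mass r s ≈ a *ᴿ mass p s +ᴿ b *ᴿ mass q s) → r ∈ X

-- X contains every distribution all of whose sup-norm neighbourhoods meet X.
-- As Ω is finite, this is closedness in ℝ^Ω.
Closed : ∀ {n} → Pred (𝔻 n) 0ℓ → Set
Closed X = ∀ q →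
           (∀ ε → 0ℚ ℚ.< ε → ∃[ p ] p ∈ X ×
              (∀ s → mass p s ≤ mass q s +ᴿ constᴿ ε × mass q s ≤ mass p s +ᴿ constᴿ ε)) →
           q ∈ X

------------------------------------------------------------------------
-- Programs and tests

Program : ∀ {n} → (Fin n → Pred (𝔻 n) 0ℓ) → Set
Program r = ∀ s → Satisfiable (r s) × Convex (r s) × Closed (r s)

Test : ∀ {n} → (Fin n → Pred (𝔻 n) 0ℓ) → Set
Test b = ∀ s {p} → p ∈ b s → p ≈ᴰ point s

record ℍ̄ (n : ℕ) : Set₁ where
  field
    out      : Fin n → Pred (𝔻 n) 0ℓ
    out-resp : ∀ s → out s Respects _≈ᴰ_
    kind     : Program out ⊎ Test out

open ℍ̄ public

infix 4 _⊑ᴴ_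

_⊑ᴴ_ : ∀ {n} → ℍ̄ n → ℍ̄ n → Set
r ⊑ᴴ r′ = ∀ s → out r s ⊆ out r′ s

δ : ∀ {n} → ℍ̄ n
δ .out s p = p ≈ᴰ point s
δ .out-resp s {p} {q} p≈q p≈δ t =
  ≈-trans {mass q t} {mass p t} {mass (point s) t}
    (≈-sym {mass p t} {mass q t} (p≈q t)) (p≈δ t)
δ .kind = inj₂ (λ s {p} p≈δ → p≈δ)

------------------------------------------------------------------------
-- Bundle event structures with internal probability

MutuallyConflicting : {A : Set} → (A → A → Set₁) → Pred A 0ℓ → Set₁
MutuallyConflicting _#_ x = ∀ {e e′} → e ∈ x → e′ ∈ x → e ≢ e′ → e # e′

record ipBES (n : ℕ) : Set₂ where
  infix 4 _↦_ _#_
  field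
    Event    : Set
    _↦_      : Pred Event 0ℓ → Event → Set₁
    _#_      : Event → Event → Set₁
    label    : Event → ℍ̄ n
    Φ        : Pred (Pred Event 0ℓ) 1ℓ
    #-irrefl : Irreflexive _≡_ _#_
    #-sym    : Symmetric _#_
    ↦-conf   : ∀ {x e} → x ↦ e → MutuallyConflicting _#_ x
    Φ-conf   : ∀ {x} → x ∈ Φ → MutuallyConflicting _#_ x

open ipBES public using (Event; label; Φ)

-- the set in(E)
Initial : ∀ {n} (E : ipBES n) → Pred (Event E) 1ℓ
Initial E e = ∀ x → ¬ (x ↦ e)
  where open ipBES E

IsZero : ∀ {n} → ipBES n → Set₁
IsZero E = ¬ Event E × Empty (Φ E)

------------------------------------------------------------------------
-- Traces and simulations

module _ {n : ℕ} (E : ipBES n) where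
  open ipBES E using (_↦_; _#_)

  record IsTrace (α : List (Event E)) : Set₁ where
    field
      distinct      : Unique α
      conflict-free : AllPairs (λ e e′ → ¬ (e # e′)) α
      secured       : ∀ β e γ → α ≡ β ++ e ∷ γ → ∀ x → x ↦ e → Any x β

  record Trace : Set₁ where
    constructor _,_
    field
      events  : List (Event E)
      isTrace : IsTrace events

  Maximal : List (Event E) → Set₁
  Maximal α = IsTrace α × (∀ β → IsTrace (α ++ β) → β ≡ [])

  WeaklyMaximal : List (Event E) → Set₁
  WeaklyMaximal α =
    Maximal α ⊎ ∃[ es ] Maximal (α ++ es) × All (λ e → δ ⊑ᴴ label E e) es

open Trace public

record t-Simulation {n : ℕ} (E F : ipBES n) : Set₁ where
  field
    f      : Trace E → Trace F
    -- traces are identified with their underlying sequences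
    f-cong : ∀ {α α′ : Trace E} → events α ≡ events α′ → events (f α) ≡ events (f α′)

    f-empty  : ∀ (α : Trace E) → events α ≡ [] → events (f α) ≡ []
    f-finite : ∀ (β : Trace F) → ∃[ L ] (∀ (α : Trace E) → events (f α) ≡ events β → events α ∈ˡ L)

    f-step : ∀ (α : Trace E) e (αe : Trace E) → events αe ≡ events α ∷ʳ e →
             (events (f αe) ≡ events (f α) × label E e ⊑ᴴ δ)
             ⊎ (∃[ e′ ] label E e ⊑ᴴ label F e′ × events (f αe) ≡ events (f α) ∷ʳ e′)

    f-max  : ∀ (α : Trace E) e (αe : Trace E) → events αe ≡ events α ∷ʳ e →
             Maximal E (events αe) →
             (∃[ e′ ] events (f αe) ≡ events (f α) ∷ʳ e′ × label E e ⊑ᴴ label F e′)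
             × WeaklyMaximal F (events (f αe))

infix 3 _⊑sim_ _≡sim_

_⊑sim_ : ∀ {n} → ipBES n → ipBES n → Set₁
E ⊑sim F = t-Simulation E F

_≡sim_ : ∀ {n} → ipBES n → ipBES n → Set₁
E ≡sim F = E ⊑sim F × F ⊑sim E

------------------------------------------------------------------------
-- Operations. Disjoint unions of event sets are sum types; a subset of a sum
-- is written x ⟨⊎⟩ y, where x and y are its parts in the two summands.

data Symmetrise {A : Set} (R : A → A → Set₁) : A → A → Set₁ where
  fwd : ∀ {a b} → R a b → Symmetrise R a b
  bwd : ∀ {a b} → R a b → Symmetrise R b a

module _ {n : ℕ} (E F : ipBES n) where
  private
    module E = ipBES E
    module F = ipBES F

  ⊎Event : Set
  ⊎Event = E.Event ⊎ F.Event

  ⊎label : ⊎Event → ℍ̄ n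
  ⊎label (inj₁ e) = E.label e
  ⊎label (inj₂ f) = F.label f

  ⊎Conflict : ⊎Event → ⊎Event → Set₁
  ⊎Conflict = Pointwise E._#_ F._#_

  data ⊎Bundle : Pred ⊎Event 0ℓ → ⊎Event → Set₁ where
    left  : ∀ {x e} → x E.↦ e → ⊎Bundle (x ⟨⊎⟩ ∅) (inj₁ e)
    right : ∀ {y f} → y F.↦ f → ⊎Bundle (∅ ⟨⊎⟩ y) (inj₂ f)

  -- in(E) ∪ in(F)
  ⊎Initial : Pred ⊎Event 1ℓ
  ⊎Initial = Initial E ⟨⊎⟩ Initial F

  ⊎irrefl : Irreflexive _≡_ ⊎Conflict
  ⊎irrefl refl (inj₁ c) = E.#-irrefl refl c
  ⊎irrefl refl (inj₂ c) = F.#-irrefl refl c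

  ⊎sym : Symmetric ⊎Conflict
  ⊎sym (inj₁ c) = inj₁ (E.#-sym c)
  ⊎sym (inj₂ c) = inj₂ (F.#-sym c)

  left-conf : ∀ {x} → MutuallyConflicting E._#_ x → MutuallyConflicting ⊎Conflict (x ⟨⊎⟩ ∅)
  left-conf h {inj₁ _} {inj₁ _} a b ne = inj₁ (h a b (λ { refl → ne refl }))

  right-conf : ∀ {y} → MutuallyConflicting F._#_ y → MutuallyConflicting ⊎Conflict (∅ ⟨⊎⟩ y)
  right-conf h {inj₂ _} {inj₂ _} a b ne = inj₂ (h a b (λ { refl → ne refl }))

  ⊎Bundle-conf : ∀ {x e} → ⊎Bundle x e → MutuallyConflicting ⊎Conflict x
  ⊎Bundle-conf (left b)  = left-conf (E.↦-conf b)
  ⊎Bundle-conf (right b) = right-conf (F.↦-conf b)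

module Parallel {n : ℕ} (E F : ipBES n) where

  data Exit : Pred (Pred (⊎Event E F) 0ℓ) 1ℓ where
    left  : ∀ {x} → x ∈ Φ E → Exit (x ⟨⊎⟩ ∅)
    right : ∀ {y} → y ∈ Φ F → Exit (∅ ⟨⊎⟩ y)

  Exit-conf : ∀ {z} → Exit z → MutuallyConflicting (⊎Conflict E F) z
  Exit-conf (left p)  = left-conf E F (ipBES.Φ-conf E p)
  Exit-conf (right p) = right-conf E F (ipBES.Φ-conf F p)

infixr 5 _∥_
_∥_ : ∀ {n} → ipBES n → ipBES n → ipBES n
E ∥ F = record
  { Event    = ⊎Event E F
  ; _↦_      = ⊎Bundle E F
  ; _#_      = ⊎Conflict E F
  ; label    = ⊎label E F
  ; Φ        = Parallel.Exit E F
  ; #-irrefl = ⊎irrefl E F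
  ; #-sym    = ⊎sym E F
  ; ↦-conf   = ⊎Bundle-conf E F
  ; Φ-conf   = Parallel.Exit-conf E F
  }

-- For a zero operand, the generic clauses give the other operand up to renaming,
-- except possibly for the exit sets. The constructors zeroˡ and zeroʳ, here and in
-- Sequential, add exactly the exit sets required by 0 + E = E + 0 = E and E · 0 = E
-- (0 · F = F needs nothing).
module Sum {n : ℕ} (E F : ipBES n) where

  data Cross : ⊎Event E F → ⊎Event E F → Set₁ where
    initial : ∀ {e f} → e ∈ Initial E → f ∈ Initial F → Cross (inj₁ e) (inj₂ f)
    exit    : ∀ {x y e f} → x ∈ Φ E → y ∈ Φ F → e ∈ x → f ∈ y → Cross (inj₁ e) (inj₂ f)

  data Conflict (a b : ⊎Event E F) : Set₁ where
    within : ⊎Conflict E F a b → Conflict a b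
    across : Symmetrise Cross a b → Conflict a b

  data Exit : Pred (Pred (⊎Event E F) 0ℓ) 1ℓ where
    join  : ∀ {x y} → x ∈ Φ E → y ∈ Φ F → Exit (x ⟨⊎⟩ y)
    zeroʳ : ∀ {x} → IsZero F → x ∈ Φ E → Exit (x ⟨⊎⟩ ∅)
    zeroˡ : ∀ {y} → IsZero E → y ∈ Φ F → Exit (∅ ⟨⊎⟩ y)

  irrefl : Irreflexive _≡_ Conflict
  irrefl refl (within c) = ⊎irrefl E F refl c
  irrefl {inj₁ _} refl (across (fwd ()))
  irrefl {inj₁ _} refl (across (bwd ()))
  irrefl {inj₂ _} refl (across (fwd ()))
  irrefl {inj₂ _} refl (across (bwd ()))

  symm : Symmetric Conflict
  symm (within c)       = within (⊎sym E F c)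
  symm (across (fwd c)) = across (bwd c)
  symm (across (bwd c)) = across (fwd c)

  Exit-conf : ∀ {z} → Exit z → MutuallyConflicting Conflict z
  Exit-conf (join p q) {inj₁ _} {inj₁ _} a b ne =
    within (inj₁ (ipBES.Φ-conf E p a b (λ { refl → ne refl })))
  Exit-conf (join p q) {inj₁ _} {inj₂ _} a b ne = across (fwd (exit p q a b))
  Exit-conf (join p q) {inj₂ _} {inj₁ _} a b ne = across (bwd (exit p q b a))
  Exit-conf (join p q) {inj₂ _} {inj₂ _} a b ne =
    within (inj₂ (ipBES.Φ-conf F q a b (λ { refl → ne refl })))
  Exit-conf (zeroʳ _ p) a b ne = within (left-conf E F (ipBES.Φ-conf E p) a b ne)
  Exit-conf (zeroˡ _ q) a b ne = within (right-conf E F (ipBES.Φ-conf F q) a b ne)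

infixl 6 _+_
_+_ : ∀ {n} → ipBES n → ipBES n → ipBES n
E + F = record
  { Event    = ⊎Event E F
  ; _↦_      = ⊎Bundle E F
  ; _#_      = Sum.Conflict E F
  ; label    = ⊎label E F
  ; Φ        = Sum.Exit E F
  ; #-irrefl = Sum.irrefl E F
  ; #-sym    = Sum.symm E F
  ; ↦-conf   = λ b p q ne → Sum.within (⊎Bundle-conf E F b p q ne)
  ; Φ-conf   = Sum.Exit-conf E F
  }

module Sequential {n : ℕ} (E F : ipBES n) where

  data Bundle : Pred (⊎Event E F) 0ℓ → ⊎Event E F → Set₁ where
    within : ∀ {x a} → ⊎Bundle E F x a → Bundle x a
    link   : ∀ {x f} → x ∈ Φ E → f ∈ Initial F → Bundle (x ⟨⊎⟩ ∅) (inj₂ f)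

  data Exit : Pred (Pred (⊎Event E F) 0ℓ) 1ℓ where
    right : ∀ {y} → y ∈ Φ F → Exit (∅ ⟨⊎⟩ y)
    zeroʳ : ∀ {x} → IsZero F → x ∈ Φ E → Exit (x ⟨⊎⟩ ∅)

  Bundle-conf : ∀ {x a} → Bundle x a → MutuallyConflicting (⊎Conflict E F) x
  Bundle-conf (within b) = ⊎Bundle-conf E F b
  Bundle-conf (link p _) = left-conf E F (ipBES.Φ-conf E p)

  Exit-conf : ∀ {z} → Exit z → MutuallyConflicting (⊎Conflict E F) z
  Exit-conf (right q)   = right-conf E F (ipBES.Φ-conf F q)
  Exit-conf (zeroʳ _ p) = left-conf E F (ipBES.Φ-conf E p)

infixl 7 _·_
_·_ : ∀ {n} → ipBES n → ipBES n → ipBES n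
E · F = record
  { Event    = ⊎Event E F
  ; _↦_      = Sequential.Bundle E F
  ; _#_      = ⊎Conflict E F
  ; label    = ⊎label E F
  ; Φ        = Sequential.Exit E F
  ; #-irrefl = ⊎irrefl E F
  ; #-sym    = ⊎sym E F
  ; ↦-conf   = Sequential.Bundle-conf E F
  ; Φ-conf   = Sequential.Exit-conf E F
  }

-- The limit of F, F + E · F, F + E · (F + E · F), … for E ≠ 0. The event (k , a)
-- is the copy of a in E_k or F_k.
module Limit {n : ℕ} (E F : ipBES n) where

  Copies : Set
  Copies = ℕ × ⊎Event E F

  only : ℕ → Pred (⊎Event E F) 0ℓ → Pred Copies 0ℓ
  only k x (j , a) = j ≡ k × a ∈ x

  data Bundle : Pred Copies 0ℓ → Copies → Set₁ where
    copy : ∀ {k x a} → ⊎Bundle E F x a → Bundle (only k x) (k , a)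
    link : ∀ {k x a} → x ∈ Φ E → a ∈ ⊎Initial E F →
           Bundle (only k (x ⟨⊎⟩ ∅)) (suc k , a)

  -- AfterChoice k is the set of initial events of E_k · (F_{k+1} + E_{k+1} · …),
  -- the structure to which F_k is added. When Φ E is empty, sequential composition
  -- adds no bundles, so the initial events of later copies are initial there too
  -- and each finite approximant of the limit makes them conflict with in(F_k).
  -- When Φ E is non-empty, only in(E_k) remains.
  data AfterChoice (k : ℕ) : Pred Copies 1ℓ where
    here  : ∀ {e} → e ∈ Initial E → AfterChoice k (k , inj₁ e)
    later : ∀ {j a} → Empty (Φ E) → k <ⁿ j → a ∈ ⊎Initial E F → AfterChoice k (j , a)

  data Cross : Copies → Copies → Set₁ where
    initial : ∀ {k f c} → f ∈ Initial F → c ∈ AfterChoice k → Cross (k , inj₂ f) c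
    exit    : ∀ {k j x y f f′} → k ≢ j → x ∈ Φ F → y ∈ Φ F → f ∈ x → f′ ∈ y →
              Cross (k , inj₂ f) (j , inj₂ f′)

  data Conflict : Copies → Copies → Set₁ where
    copy   : ∀ {k a b} → ⊎Conflict E F a b → Conflict (k , a) (k , b)
    across : ∀ {c d} → Symmetrise Cross c d → Conflict c d

  data Exit : Pred (Pred Copies 0ℓ) 1ℓ where
    unions : (x : ℕ → Pred (Event F) 0ℓ) → (∀ k → x k ∈ Φ F) →
             Exit (λ c → proj₂ c ∈ (∅ ⟨⊎⟩ x (proj₁ c)))

  Cross-irrefl : ∀ {c} → ¬ Cross c c
  Cross-irrefl (initial _ (later _ k<k _)) = ℕₚ.<-irrefl refl k<k
  Cross-irrefl (exit k≢k _ _ _ _)          = k≢k refl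

  irrefl : Irreflexive _≡_ Conflict
  irrefl refl (copy c)         = ⊎irrefl E F refl c
  irrefl refl (across (fwd c)) = Cross-irrefl c
  irrefl refl (across (bwd c)) = Cross-irrefl c

  symm : Symmetric Conflict
  symm (copy c)         = copy (⊎sym E F c)
  symm (across (fwd c)) = across (bwd c)
  symm (across (bwd c)) = across (fwd c)

  only-conf : ∀ {k x} → MutuallyConflicting (⊎Conflict E F) x →
              MutuallyConflicting Conflict (only k x)
  only-conf h (refl , a) (refl , b) ne = copy (h a b (λ { refl → ne refl }))

  Bundle-conf : ∀ {x c} → Bundle x c → MutuallyConflicting Conflict x
  Bundle-conf (copy b)   = only-conf (⊎Bundle-conf E F b)
  Bundle-conf (link p _) = only-conf (left-conf E F (ipBES.Φ-conf E p))

  Exit-conf : ∀ {z} → Exit z → MutuallyConflicting Conflict z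
  Exit-conf (unions x x∈Φ) {k , inj₂ _} {j , inj₂ _} a b ne with k ℕₚ.≟ j
  ... | yes refl = copy (inj₂ (ipBES.Φ-conf F (x∈Φ k) a b (λ { refl → ne refl })))
  ... | no k≢j   = across (fwd (exit k≢j (x∈Φ k) (x∈Φ j) a b))

limit : ∀ {n} → ipBES n → ipBES n → ipBES n
limit E F = record
  { Event    = Limit.Copies E F
  ; _↦_      = Limit.Bundle E F
  ; _#_      = Limit.Conflict E F
  ; label    = λ c → ⊎label E F (proj₂ c)
  ; Φ        = Limit.Exit E F
  ; #-irrefl = Limit.irrefl E F
  ; #-sym    = Limit.symm E F
  ; ↦-conf   = Limit.Bundle-conf E F
  ; Φ-conf   = Limit.Exit-conf E F
  }

-- E * F; excluded middle decides the case distinction on E = 0.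
infixr 8 _*[_]_
_*[_]_ : ∀ {n} → ipBES n → ExcludedMiddle 1ℓ → ipBES n → ipBES n
E *[ em ] F = if does (em {IsZero E}) then F else limit E F

{-# OPTIONS --safe #-}

-- The laws for ∥ and the unfolding of the star are isomorphisms of event structures,
-- except that for E = 0 the latter reads F ≡ F + F. Non-empty traces of E + F lie in one
-- summand, as initial events of E and F are in conflict; so + is a join for ⊑sim,
-- which gives its monotonicity. For G · E, a trace is an interleaving of a trace of G with
-- a trace of E whose first event comes after an exit of G through every set of Φ; a
-- simulation acts on the E-part of the interleaving, each event being replaced in place
-- by what it adds to the simulated trace. A maximal trace either never exits G, and then
-- contains no event of E, or has a maximal E-part. Finally, E ∥ G is G · E after
-- forgetting the exit sets of G.

module Submission where

open import Defs
open import Axiom.ExcludedMiddle using (ExcludedMiddle)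
open import Data.Empty using (⊥; ⊥-elim)
open import Data.List using (List; []; _∷_; _++_; _∷ʳ_; map; mapMaybe; drop; length; concatMap; initLast; _∷ʳ′_)
open import Data.List.Membership.Propositional using () renaming (_∈_ to _∈ˡ_)
open import Data.List.Membership.Propositional.Properties using (∈-map⁺; ∈-++⁺ˡ; ∈-++⁺ʳ; ∈-concatMap⁺)
open import Data.List.Properties
  using (∷-injective; ++-assoc; ++-identityʳ; ++-conicalˡ; ++-conicalʳ; ∷ʳ-++; map-++; map-cong; map-id; map-∘;
         mapMaybe-++; mapMaybeIsInj₁∘mapInj₁; mapMaybeIsInj₁∘mapInj₂; mapMaybeIsInj₂∘mapInj₁; mapMaybeIsInj₂∘mapInj₂)
open import Data.List.Relation.Unary.All as All using (All; []; _∷_)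
open import Data.List.Relation.Unary.All.Properties as Allₚ using (¬Any⇒All¬; All¬⇒¬Any)
open import Data.List.Relation.Unary.AllPairs as AllPairs using (AllPairs; []; _∷_)
import Data.List.Relation.Unary.AllPairs.Properties as AllPairsₚ
open import Data.List.Relation.Unary.Any as Any using (Any; here; there)
import Data.List.Relation.Unary.Any.Properties as Anyₚ
open import Data.List.Relation.Unary.Unique.Propositional using (Unique)
import Data.List.Relation.Unary.Unique.Propositional.Properties as Uniqueₚ
open import Data.Nat using (ℕ; zero; suc; s≤s; z≤n; s≤s⁻¹)
open import Data.Product using (∃-syntax; _×_; _,_; proj₁; proj₂)
open import Data.Sum using (_⊎_; inj₁; inj₂; isInj₁; isInj₂; swap; assocʳ; assocˡ)
open import Data.Sum.Properties using (swap-involutive; inj₁-injective; inj₂-injective)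
open import Data.Sum.Relation.Binary.Pointwise using (inj₁; inj₂)
open import Data.Unit.Polymorphic using (⊤; tt)
open import Function using (_∘_; const; id)
open import Level using (0ℓ; Lift; lift)
open import Relation.Binary.Definitions using (Symmetric)
open import Relation.Binary.PropositionalEquality
  using (_≡_; _≢_; refl; sym; trans; cong; subst)
open import Relation.Nullary using (¬_; yes; no)
open import Relation.Unary using (Pred; _∈_; Empty)

-- Condition (iii) speaks only of maximal traces that end in an event, so a t-simulation says
-- nothing about an empty trace that is already maximal. This is why embeddings are asked to
-- preserve maximality of nonempty traces only, and it is the obstacle in `G · E`, where a maximal
-- trace may end with `G` while `E` cannot start. Traces do not see the exit sets of the structure
-- they live in; these matter only through the bundles and conflicts that a further operation makes
-- of them. Hence isomorphisms may ignore `Φ`.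

private
  variable
    A B : Set
    n : ℕ
    E F G : ipBES n

-- Lists, and lists over a disjoint union

AllPairs-lookup : {R : A → A → Set₁} → Symmetric R → (∀ {a} → ¬ R a a) →
                  ∀ {α a b} → AllPairs (λ a b → ¬ R a b) α → a ∈ˡ α → b ∈ˡ α → ¬ R a b
AllPairs-lookup s i (_ ∷ _)  (here refl) (here refl) r = i r
AllPairs-lookup s i (h ∷ _)  (here refl) (there q)   r = All.lookup h q r
AllPairs-lookup s i (h ∷ _)  (there p)   (here refl) r = All.lookup h p (s r)
AllPairs-lookup s i (_ ∷ hs) (there p)   (there q)   r = AllPairs-lookup s i hs p q r

-- Together with `AllPairs-lookup` this makes absence of conflict a matter of membership alone, so
-- that it passes through `lefts` and `rights` whatever the order of the events.
AllPairs-tabulate : {R : A → A → Set₁} → ∀ α → (∀ {a b} → a ∈ˡ α → b ∈ˡ α → R a b) → AllPairs R α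
AllPairs-tabulate []      h = []
AllPairs-tabulate (a ∷ α) h =
  All.tabulate (λ p → h (here refl) (there p)) ∷
  AllPairs-tabulate α (λ p q → h (there p) (there q))

drop-length-++ : (α β : List A) → drop (length α) (α ++ β) ≡ β
drop-length-++ []      β = refl
drop-length-++ (_ ∷ α) β = drop-length-++ α β

∷ʳ-nonempty : (α : List A) {e : A} → α ∷ʳ e ≢ []
∷ʳ-nonempty []      ()
∷ʳ-nonempty (_ ∷ _) ()

map-[]⁻ : (φ : A → B) (α : List A) → map φ α ≡ [] → α ≡ []
map-[]⁻ φ [] _ = refl

lefts : List (A ⊎ B) → List A
lefts = mapMaybe isInj₁

rights : List (A ⊎ B) → List B
rights = mapMaybe isInj₂

lefts-++ : (α β : List (A ⊎ B)) → lefts (α ++ β) ≡ lefts α ++ lefts β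
lefts-++ = mapMaybe-++ isInj₁

rights-++ : (α β : List (A ⊎ B)) → rights (α ++ β) ≡ rights α ++ rights β
rights-++ = mapMaybe-++ isInj₂

-- Securing `e` in a projection requires knowing what precedes it in the interleaving: `β′` may
-- contain more events than `β`, but none more from the left side.
lefts-split : ∀ (α : List (A ⊎ B)) β e γ → lefts α ≡ β ++ e ∷ γ →
              ∃[ β′ ] ∃[ γ′ ] α ≡ β′ ++ inj₁ e ∷ γ′ × lefts β′ ≡ β
lefts-split []           []      e γ ()
lefts-split []           (_ ∷ _) e γ ()
lefts-split (inj₁ _ ∷ α) []      e γ refl = [] , α , refl , refl
lefts-split (inj₁ a ∷ α) (_ ∷ β) e γ eq with ∷-injective eq
... | refl , eq′ with lefts-split α β e γ eq′
... | β′ , γ′ , refl , refl = inj₁ a ∷ β′ , γ′ , refl , refl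
lefts-split (inj₂ b ∷ α) β       e γ eq with lefts-split α β e γ eq
... | β′ , γ′ , refl , refl = inj₂ b ∷ β′ , γ′ , refl , refl

rights-split : ∀ (α : List (A ⊎ B)) β e γ → rights α ≡ β ++ e ∷ γ →
               ∃[ β′ ] ∃[ γ′ ] α ≡ β′ ++ inj₂ e ∷ γ′ × rights β′ ≡ β
rights-split []           []      e γ ()
rights-split []           (_ ∷ _) e γ ()
rights-split (inj₂ _ ∷ α) []      e γ refl = [] , α , refl , refl
rights-split (inj₂ a ∷ α) (_ ∷ β) e γ eq with ∷-injective eq
... | refl , eq′ with rights-split α β e γ eq′
... | β′ , γ′ , refl , refl = inj₂ a ∷ β′ , γ′ , refl , refl
rights-split (inj₁ b ∷ α) β       e γ eq with rights-split α β e γ eq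
... | β′ , γ′ , refl , refl = inj₁ b ∷ β′ , γ′ , refl , refl

module _ {P : Pred A 0ℓ} {Q : Pred (A ⊎ B) 0ℓ} where
  -- Stated for two predicates linked by implications rather than for `P ⟨⊎⟩ ∅`, so that it serves
  -- membership as well as bundles.
  Any-lefts⁺ : (∀ {a} → Q (inj₁ a) → P a) → (∀ {b} → ¬ Q (inj₂ b)) →
               ∀ {α} → Any Q α → Any P (lefts α)
  Any-lefts⁺ h k {inj₁ _ ∷ _} (here q)  = here (h q)
  Any-lefts⁺ h k {inj₂ _ ∷ _} (here q)  = ⊥-elim (k q)
  Any-lefts⁺ h k {inj₁ _ ∷ _} (there p) = there (Any-lefts⁺ h k p)
  Any-lefts⁺ h k {inj₂ _ ∷ _} (there p) = Any-lefts⁺ h k p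

  Any-lefts⁻ : (∀ {a} → P a → Q (inj₁ a)) → ∀ α → Any P (lefts α) → Any Q α
  Any-lefts⁻ h (inj₁ _ ∷ α) (here p)  = here (h p)
  Any-lefts⁻ h (inj₁ _ ∷ α) (there p) = there (Any-lefts⁻ h α p)
  Any-lefts⁻ h (inj₂ _ ∷ α) p         = there (Any-lefts⁻ h α p)

module _ {P : Pred B 0ℓ} {Q : Pred (A ⊎ B) 0ℓ} where
  Any-rights⁺ : (∀ {b} → Q (inj₂ b) → P b) → (∀ {a} → ¬ Q (inj₁ a)) →
                ∀ {α} → Any Q α → Any P (rights α)
  Any-rights⁺ h k {inj₂ _ ∷ _} (here q)  = here (h q)
  Any-rights⁺ h k {inj₁ _ ∷ _} (here q)  = ⊥-elim (k q)
  Any-rights⁺ h k {inj₂ _ ∷ _} (there p) = there (Any-rights⁺ h k p)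
  Any-rights⁺ h k {inj₁ _ ∷ _} (there p) = Any-rights⁺ h k p

  Any-rights⁻ : (∀ {b} → P b → Q (inj₂ b)) → ∀ α → Any P (rights α) → Any Q α
  Any-rights⁻ h (inj₂ _ ∷ α) (here p)  = here (h p)
  Any-rights⁻ h (inj₂ _ ∷ α) (there p) = there (Any-rights⁻ h α p)
  Any-rights⁻ h (inj₁ _ ∷ α) p         = there (Any-rights⁻ h α p)

∈-lefts⁺ : ∀ {a : A} {α : List (A ⊎ B)} → inj₁ a ∈ˡ α → a ∈ˡ lefts α
∈-lefts⁺ = Any-lefts⁺ inj₁-injective (λ ())

∈-lefts⁻ : ∀ {a : A} (α : List (A ⊎ B)) → a ∈ˡ lefts α → inj₁ a ∈ˡ α
∈-lefts⁻ = Any-lefts⁻ (cong inj₁)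

∈-rights⁺ : ∀ {b : B} {α : List (A ⊎ B)} → inj₂ b ∈ˡ α → b ∈ˡ rights α
∈-rights⁺ = Any-rights⁺ inj₂-injective (λ ())

∈-rights⁻ : ∀ {b : B} (α : List (A ⊎ B)) → b ∈ˡ rights α → inj₂ b ∈ˡ α
∈-rights⁻ = Any-rights⁻ (cong inj₂)

Unique-lefts : (α : List (A ⊎ B)) → Unique α → Unique (lefts α)
Unique-lefts []           []       = []
Unique-lefts (inj₁ a ∷ α) (h ∷ hs) = ¬Any⇒All¬ _ (All¬⇒¬Any h ∘ ∈-lefts⁻ α) ∷ Unique-lefts α hs
Unique-lefts (inj₂ b ∷ α) (h ∷ hs) = Unique-lefts α hs

Unique-rights : (α : List (A ⊎ B)) → Unique α → Unique (rights α)
Unique-rights []           []       = []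
Unique-rights (inj₁ a ∷ α) (h ∷ hs) = Unique-rights α hs
Unique-rights (inj₂ b ∷ α) (h ∷ hs) = ¬Any⇒All¬ _ (All¬⇒¬Any h ∘ ∈-rights⁻ α) ∷ Unique-rights α hs

Unique-⊎ : (α : List (A ⊎ B)) → Unique (lefts α) → Unique (rights α) → Unique α
Unique-⊎ []           _        _        = []
Unique-⊎ (inj₁ a ∷ α) (h ∷ hs) ks       = ¬Any⇒All¬ _ (All¬⇒¬Any h ∘ ∈-lefts⁺) ∷ Unique-⊎ α hs ks
Unique-⊎ (inj₂ b ∷ α) hs       (k ∷ ks) = ¬Any⇒All¬ _ (All¬⇒¬Any k ∘ ∈-rights⁺) ∷ Unique-⊎ α hs ks

⊎-[]⁻ : (α : List (A ⊎ B)) → lefts α ≡ [] → rights α ≡ [] → α ≡ []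
⊎-[]⁻ []           _  _  = refl
⊎-[]⁻ (inj₁ _ ∷ _) () _
⊎-[]⁻ (inj₂ _ ∷ _) _  ()

rights≡[] : (α : List (A ⊎ B)) → rights α ≡ [] → map inj₁ (lefts α) ≡ α
rights≡[] []           _  = refl
rights≡[] (inj₁ a ∷ α) h  = cong (inj₁ a ∷_) (rights≡[] α h)
rights≡[] (inj₂ _ ∷ _) ()

lefts≡[] : (α : List (A ⊎ B)) → lefts α ≡ [] → map inj₂ (rights α) ≡ α
lefts≡[] []           _  = refl
lefts≡[] (inj₂ b ∷ α) h  = cong (inj₂ b ∷_) (lefts≡[] α h)
lefts≡[] (inj₁ _ ∷ _) ()

-- Prefixes are included because this avoids case distinctions; only finiteness
-- of the list matters.
shuffles : List A → List B → List (List (A ⊎ B))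
shufflesˡ : List A → List B → List (List (A ⊎ B))
shufflesʳ : List A → List B → List (List (A ⊎ B))
shuffles α β = [] ∷ (shufflesˡ α β ++ shufflesʳ α β)
shufflesˡ []      β = []
shufflesˡ (a ∷ α) β = map (inj₁ a ∷_) (shuffles α β)
shufflesʳ α []      = []
shufflesʳ α (b ∷ β) = map (inj₂ b ∷_) (shuffles α β)

∈-shuffles : (α : List (A ⊎ B)) → α ∈ˡ shuffles (lefts α) (rights α)
∈-shuffles []           = here refl
∈-shuffles (inj₁ a ∷ α) = there (∈-++⁺ˡ (∈-map⁺ (inj₁ a ∷_) (∈-shuffles α)))
∈-shuffles (inj₂ b ∷ α) =
  there (∈-++⁺ʳ (shufflesˡ (lefts α) (b ∷ rights α)) (∈-map⁺ (inj₂ b ∷_) (∈-shuffles α)))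

-- Traces

Secured : (Pred A 0ℓ → A → Set₁) → List A → Set₁
Secured _↦_ α = ∀ β e γ → α ≡ β ++ e ∷ γ → ∀ x → x ↦ e → Any x β

trace-prefix : ∀ α {β} → IsTrace E (α ++ β) → IsTrace E α
trace-prefix α {β} t = record
  { distinct      = AllPairs-++ˡ α (IsTrace.distinct t)
  ; conflict-free = AllPairs-++ˡ α (IsTrace.conflict-free t)
  ; secured       = λ δ e γ eq → IsTrace.secured t δ e (γ ++ β)
                      (trans (cong (_++ β) eq) (++-assoc δ (e ∷ γ) β))
  }
  where
  AllPairs-++ˡ : ∀ {ℓ} {R : A → A → Set ℓ} α {β} → AllPairs R (α ++ β) → AllPairs R α
  AllPairs-++ˡ []      hs       = []
  AllPairs-++ˡ (_ ∷ α) (h ∷ hs) = Allₚ.++⁻ˡ α h ∷ AllPairs-++ˡ α hs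

empty-trace : IsTrace E []
empty-trace = record
  { distinct = [] ; conflict-free = []
  ; secured = λ { [] e γ () ; (_ ∷ _) e γ () } }

-- A bundle into the first event would have to be met by an earlier one.
head-initial : ∀ {a α} → IsTrace E (a ∷ α) → a ∈ Initial E
head-initial t x b with IsTrace.secured t [] _ _ refl x b
... | ()

no-conflict : ∀ {α a b} → IsTrace E α → a ∈ˡ α → b ∈ˡ α → ¬ ipBES._#_ E a b
no-conflict {E = E} t =
  AllPairs-lookup (ipBES.#-sym E) (ipBES.#-irrefl E refl) (IsTrace.conflict-free t)

-- Maximality is the case of an extension by no events, which spares later proofs the case
-- distinction.
weaken-max : ∀ {α} → WeaklyMaximal E α →
             ∃[ es ] Maximal E (α ++ es) × All (λ e → δ ⊑ᴴ label E e) es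
weaken-max {E = E} {α} (inj₁ m) = [] , subst (Maximal E) (sym (++-identityʳ α)) m , []
weaken-max (inj₂ m) = m

-- Neither side constrains the other in `E ∥ F`, so every interleaving of two traces is allowed. The
-- traces of `+` and `·` are obtained from these, as both operations only add conflicts or bundles.
∥-trace⁺ : ∀ {α} → IsTrace E (lefts α) → IsTrace F (rights α) → IsTrace (E ∥ F) α
∥-trace⁺ {E = E} {F = F} {α} s t = record
  { distinct      = Unique-⊎ α (IsTrace.distinct s) (IsTrace.distinct t)
  ; conflict-free = AllPairs-tabulate α λ where
      p q (inj₁ c) → no-conflict s (∈-lefts⁺ p) (∈-lefts⁺ q) c
      p q (inj₂ c) → no-conflict t (∈-rights⁺ p) (∈-rights⁺ q) c
  ; secured       = secured
  }
  where
  secured : Secured (⊎Bundle E F) α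
  secured β (inj₁ e) γ refl _ (left b) =
    Any-lefts⁻ id β (IsTrace.secured s (lefts β) e (lefts γ) (lefts-++ β _) _ b)
  secured β (inj₂ e) γ refl _ (right b) =
    Any-rights⁻ id β (IsTrace.secured t (rights β) e (rights γ) (rights-++ β _) _ b)

∥-traceˡ : ∀ {α} → IsTrace (E ∥ F) α → IsTrace E (lefts α)
∥-traceˡ {E = E} {F = F} {α} t = record
  { distinct      = Unique-lefts α (IsTrace.distinct t)
  ; conflict-free = AllPairs-tabulate _ λ p q c → no-conflict t (∈-lefts⁻ α p) (∈-lefts⁻ α q) (inj₁ c)
  ; secured       = secured
  }
  where
  secured : Secured (ipBES._↦_ E) (lefts α)
  secured β e γ eq x b with lefts-split α β e γ eq
  ... | β′ , γ′ , eq′ , refl =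
    Any-lefts⁺ id id (IsTrace.secured t β′ (inj₁ e) γ′ eq′ _ (left b))

∥-traceʳ : ∀ {α} → IsTrace (E ∥ F) α → IsTrace F (rights α)
∥-traceʳ {E = E} {F = F} {α} t = record
  { distinct      = Unique-rights α (IsTrace.distinct t)
  ; conflict-free = AllPairs-tabulate _ λ p q c → no-conflict t (∈-rights⁻ α p) (∈-rights⁻ α q) (inj₂ c)
  ; secured       = secured
  }
  where
  secured : Secured (ipBES._↦_ F) (rights α)
  secured β e γ eq x b with rights-split α β e γ eq
  ... | β′ , γ′ , eq′ , refl =
    Any-rights⁺ id id (IsTrace.secured t β′ (inj₂ e) γ′ eq′ _ (right b))

-- Simulations on lists

-- Excluded middle turns a t-simulation into a total function on event sequences
-- and lifts the finiteness condition to all sequences.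
record Simulation {n : ℕ} (E F : ipBES n) : Set₁ where
  field
    f        : List (Event E) → List (Event F)
    f-trace  : ∀ {α} → IsTrace E α → IsTrace F (f α)
    f-empty  : f [] ≡ []
    f-finite : ∀ β → ∃[ L ] (∀ {α} → IsTrace E α → f α ≡ β → α ∈ˡ L)
    f-step   : ∀ α e → IsTrace E (α ∷ʳ e) →
               (f (α ∷ʳ e) ≡ f α × label E e ⊑ᴴ δ)
               ⊎ (∃[ e′ ] label E e ⊑ᴴ label F e′ × f (α ∷ʳ e) ≡ f α ∷ʳ e′)
    f-max    : ∀ α e → Maximal E (α ∷ʳ e) →
               (∃[ e′ ] f (α ∷ʳ e) ≡ f α ∷ʳ e′ × label E e ⊑ᴴ label F e′)
               × WeaklyMaximal F (f (α ∷ʳ e))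

toSimulation : ExcludedMiddle 1ℓ → E ⊑sim F → Simulation E F
toSimulation {E = E} {F = F} em S = record
  { f        = h
  ; f-trace  = λ t → subst (IsTrace F) (sym (h≡ t)) (isTrace (S.f (_ , t)))
  ; f-empty  = trans (h≡ empty-trace) (S.f-empty _ refl)
  ; f-finite = finite
  ; f-step   = step
  ; f-max    = max
  }
  where
  module S = t-Simulation S
  h : List (Event E) → List (Event F)
  h α with em {IsTrace E α}
  ... | yes t = events (S.f (α , t))
  -- An arbitrary default: the conditions on `h` concern traces only.
  ... | no  _ = []
  h≡ : ∀ {α} (t : IsTrace E α) → h α ≡ events (S.f (α , t))
  h≡ {α} t with em {IsTrace E α}
  -- The proof found by `em` may differ from `t`; `f-cong` makes the value independent of it.
  ... | yes _ = S.f-cong refl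
  ... | no ¬t = ⊥-elim (¬t t)
  finite : ∀ β → ∃[ L ] (∀ {α} → IsTrace E α → h α ≡ β → α ∈ˡ L)
  finite β with em {IsTrace F β}
  ... | yes u = proj₁ (S.f-finite (β , u)) , λ t eq →
    proj₂ (S.f-finite (β , u)) (_ , t) (trans (sym (h≡ t)) eq)
  -- A sequence that is not a trace has no preimage, since images of traces are traces.
  ... | no ¬u = [] , λ t eq →
    ⊥-elim (¬u (subst (IsTrace F) (trans (sym (h≡ t)) eq) (isTrace (S.f (_ , t)))))
  step : ∀ α e → IsTrace E (α ∷ʳ e) →
         (h (α ∷ʳ e) ≡ h α × label E e ⊑ᴴ δ)
         ⊎ (∃[ e′ ] label E e ⊑ᴴ label F e′ × h (α ∷ʳ e) ≡ h α ∷ʳ e′)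
  step α e t rewrite h≡ t | h≡ (trace-prefix α t) = S.f-step (α , trace-prefix α t) e (_ , t) refl
  max : ∀ α e → Maximal E (α ∷ʳ e) →
        (∃[ e′ ] h (α ∷ʳ e) ≡ h α ∷ʳ e′ × label E e ⊑ᴴ label F e′)
        × WeaklyMaximal F (h (α ∷ʳ e))
  max α e m rewrite h≡ (proj₁ m) | h≡ (trace-prefix α (proj₁ m)) =
    S.f-max (α , trace-prefix α (proj₁ m)) e (_ , proj₁ m) refl m

fromSimulation : Simulation E F → E ⊑sim F
fromSimulation {E = E} {F = F} S = record
  { f        = λ α → S.f (events α) , S.f-trace (isTrace α)
  ; f-cong   = cong S.f
  ; f-empty  = λ { _ refl → S.f-empty }
  ; f-finite = λ β → proj₁ (S.f-finite (events β)) , λ α → proj₂ (S.f-finite (events β)) (isTrace α)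
  ; f-step   = λ { α e αe refl → S.f-step (events α) e (isTrace αe) }
  ; f-max    = λ { α e αe refl → S.f-max (events α) e }
  }
  where module S = Simulation S

id-simulation : Simulation E E
id-simulation = record
  { f        = id
  ; f-trace  = id
  ; f-empty  = refl
  ; f-finite = λ β → β ∷ [] , λ { _ refl → here refl }
  ; f-step   = λ α e _ → inj₂ (e , (λ _ p → p) , refl)
  ; f-max    = λ α e m → (e , refl , (λ _ p → p)) , inj₁ m
  }

-- Embeddings and isomorphisms

-- t-simulations need not compose as functions: after a weakly maximal trace the second one may
-- drop the last event. Composing with an embedding on either side is harmless.
record Embedding {n : ℕ} (E F : ipBES n) : Set₁ where
  field
    to         : Event E → Event F
    unmap      : List (Event F) → List (Event E)
    unmap-map  : ∀ α → unmap (map to α) ≡ α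
    label-to   : ∀ e → label F (to e) ≡ label E e
    to-trace   : ∀ {α} → IsTrace E α → IsTrace F (map to α)
    to-maximal : ∀ {α} → α ≢ [] → Maximal E α → Maximal F (map to α)

  map-∷ʳ : ∀ α e → map to (α ∷ʳ e) ≡ map to α ∷ʳ to e
  map-∷ʳ α e = map-++ to α (e ∷ [])

  label-mono : ∀ {r : ℍ̄ n} e → r ⊑ᴴ label E e → r ⊑ᴴ label F (to e)
  label-mono {r} e = subst (r ⊑ᴴ_) (sym (label-to e))

embedding-simulation : Embedding E F → Simulation F G → Simulation E G
embedding-simulation {E = E} {F = F} {G = G} I S = record
  { f        = S.f ∘ map I.to
  ; f-trace  = S.f-trace ∘ I.to-trace
  ; f-empty  = S.f-empty
  ; f-finite = λ β → map I.unmap (proj₁ (S.f-finite β)) , λ {α} t eq →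
      subst (_∈ˡ _) (I.unmap-map α) (∈-map⁺ I.unmap (proj₂ (S.f-finite β) (I.to-trace t) eq))
  ; f-step   = step
  ; f-max    = max
  }
  where
  module I = Embedding I
  module S = Simulation S
  step : ∀ α e → IsTrace E (α ∷ʳ e) →
         (S.f (map I.to (α ∷ʳ e)) ≡ S.f (map I.to α) × label E e ⊑ᴴ δ)
         ⊎ (∃[ e′ ] label E e ⊑ᴴ label G e′ × S.f (map I.to (α ∷ʳ e)) ≡ S.f (map I.to α) ∷ʳ e′)
  step α e t with I.to-trace t
  ... | u rewrite I.map-∷ʳ α e | sym (I.label-to e) = S.f-step _ _ u
  max : ∀ α e → Maximal E (α ∷ʳ e) →
        (∃[ e′ ] S.f (map I.to (α ∷ʳ e)) ≡ S.f (map I.to α) ∷ʳ e′ × label E e ⊑ᴴ label G e′)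
        × WeaklyMaximal G (S.f (map I.to (α ∷ʳ e)))
  max α e m with I.to-maximal (∷ʳ-nonempty α) m
  ... | m′ rewrite I.map-∷ʳ α e | sym (I.label-to e) = S.f-max _ _ m′

simulation-embedding : Simulation E F → Embedding F G → Simulation E G
simulation-embedding {E = E} {F = F} {G = G} S I = record
  { f        = map I.to ∘ S.f
  ; f-trace  = I.to-trace ∘ S.f-trace
  ; f-empty  = cong (map I.to) S.f-empty
  ; f-finite = λ β → proj₁ (S.f-finite (I.unmap β)) , λ {α} t eq →
      proj₂ (S.f-finite (I.unmap β)) t (trans (sym (I.unmap-map (S.f α))) (cong I.unmap eq))
  ; f-step   = step
  ; f-max    = max
  }
  where
  module I = Embedding I
  module S = Simulation S
  map-f-∷ʳ : ∀ {α e e′} → S.f (α ∷ʳ e) ≡ S.f α ∷ʳ e′ →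
             map I.to (S.f (α ∷ʳ e)) ≡ map I.to (S.f α) ∷ʳ I.to e′
  map-f-∷ʳ eq = trans (cong (map I.to) eq) (I.map-∷ʳ _ _)
  step : ∀ α e → IsTrace E (α ∷ʳ e) →
         (map I.to (S.f (α ∷ʳ e)) ≡ map I.to (S.f α) × label E e ⊑ᴴ δ)
         ⊎ (∃[ e′ ] label E e ⊑ᴴ label G e′ × map I.to (S.f (α ∷ʳ e)) ≡ map I.to (S.f α) ∷ʳ e′)
  step α e t with S.f-step α e t
  ... | inj₁ (eq , l)      = inj₁ (cong (map I.to) eq , l)
  ... | inj₂ (e′ , l , eq) = inj₂ (I.to e′ , I.label-mono {label E e} e′ l , map-f-∷ʳ eq)
  max : ∀ α e → Maximal E (α ∷ʳ e) →
        (∃[ e′ ] map I.to (S.f (α ∷ʳ e)) ≡ map I.to (S.f α) ∷ʳ e′ × label E e ⊑ᴴ label G e′)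
        × WeaklyMaximal G (map I.to (S.f (α ∷ʳ e)))
  max α e m with S.f-max α e m
  ... | (e′ , eq , l) , w with weaken-max w
  ... | es , m′ , ls =
    (I.to e′ , map-f-∷ʳ eq , I.label-mono {label E e} e′ l) ,
    inj₂ (map I.to es ,
          subst (Maximal G) (map-++ I.to (S.f (α ∷ʳ e)) es) (I.to-maximal nonempty m′) ,
          Allₚ.map⁺ (All.map (λ {x} → I.label-mono {δ} x) ls))
    where
    -- `f-max` keeps the last event, so the image is nonempty, as `to-maximal` demands.
    nonempty : S.f (α ∷ʳ e) ++ es ≢ []
    nonempty q = ∷ʳ-nonempty (S.f α) (trans (sym eq) (++-conicalˡ _ _ q))

infix 4 _≅_

-- Transporting traces only requires that conflicts and bundles be reflected, in each direction. For
-- a bundle `y` an inclusion suffices: if the image of `x` lies in `y`, then meeting `x` meets `y`.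
-- This also avoids equations between predicates.
record _≅_ {n : ℕ} (E F : ipBES n) : Set₁ where
  private
    module E = ipBES E
    module F = ipBES F
  field
    to              : Event E → Event F
    from            : Event F → Event E
    from∘to         : ∀ e → from (to e) ≡ e
    to∘from         : ∀ e → to (from e) ≡ e
    label-to        : ∀ e → label F (to e) ≡ label E e
    conflict-to⁻    : ∀ e e′ → to e F.# to e′ → e E.# e′
    conflict-from⁻  : ∀ e e′ → from e E.# from e′ → e F.# e′
    bundle-to⁻      : ∀ {y} e → y F.↦ to e → ∃[ x ] x E.↦ e × (∀ e′ → x e′ → y (to e′))
    bundle-from⁻    : ∀ {x} e → x E.↦ from e → ∃[ y ] y F.↦ e × (∀ e′ → y e′ → x (from e′))

≅-sym : E ≅ F → F ≅ E
≅-sym {E = E} {F = F} I = record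
  { to             = I.from
  ; from           = I.to
  ; from∘to        = I.to∘from
  ; to∘from        = I.from∘to
  ; label-to       = λ e → trans (sym (I.label-to (I.from e))) (cong (label F) (I.to∘from e))
  ; conflict-to⁻   = I.conflict-from⁻
  ; conflict-from⁻ = I.conflict-to⁻
  ; bundle-to⁻     = I.bundle-from⁻
  ; bundle-from⁻   = I.bundle-to⁻
  }
  where module I = _≅_ I

map-inverse : {φ : A → B} {ψ : B → A} → (∀ a → ψ (φ a) ≡ a) → ∀ α → map ψ (map φ α) ≡ α
map-inverse inv α = trans (sym (map-∘ α)) (trans (map-cong inv α) (map-id α))

≅-trace : (I : E ≅ F) → ∀ {α} → IsTrace E α → IsTrace F (map (_≅_.to I) α)
≅-trace {E = E} {F = F} I {α} t = record
  { distinct      = Uniqueₚ.map⁺ injective (IsTrace.distinct t)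
  ; conflict-free = AllPairsₚ.map⁺ (AllPairs.map (_∘ I.conflict-to⁻ _ _) (IsTrace.conflict-free t))
  ; secured       = secured
  }
  where
  module I = _≅_ I
  injective : ∀ {a b} → I.to a ≡ I.to b → a ≡ b
  injective eq = trans (sym (I.from∘to _)) (trans (cong I.from eq) (I.from∘to _))
  secured : Secured (ipBES._↦_ F) (map I.to α)
  secured β e γ eq y b with I.bundle-to⁻ (I.from e) (subst (ipBES._↦_ F y) (sym (I.to∘from e)) b)
  ... | x , b′ , h =
    Any.map (λ {c} p → subst y (I.to∘from c) (h _ p)) (Anyₚ.map⁻
      (IsTrace.secured t (map I.from β) (I.from e) (map I.from γ)
        (trans (sym (map-inverse I.from∘to α)) (trans (cong (map I.from) eq) (map-++ I.from β (e ∷ γ))))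
        x b′))

≅⇒embedding : E ≅ F → Embedding E F
≅⇒embedding {E = E} {F = F} I = record
  { to         = I.to
  ; unmap      = map I.from
  ; unmap-map  = map-inverse I.from∘to
  ; label-to   = I.label-to
  ; to-trace   = ≅-trace I
  ; to-maximal = λ {α} _ m → ≅-trace I (proj₁ m) , λ β t →
      map-[]⁻ I.from β (proj₂ m (map I.from β)
        (subst (IsTrace E)
          (trans (map-++ I.from (map I.to α) β) (cong (_++ map I.from β) (map-inverse I.from∘to α)))
          (≅-trace (≅-sym I) t)))
  }
  where module I = _≅_ I

embedding⇒⊑ : Embedding E F → E ⊑sim F
embedding⇒⊑ I = fromSimulation (embedding-simulation I id-simulation)

≅⇒≡sim : E ≅ F → E ≡sim F
≅⇒≡sim I = embedding⇒⊑ (≅⇒embedding I) , embedding⇒⊑ (≅⇒embedding (≅-sym I))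

-- Sums

-- The first events of the two parts would be initial, hence in conflict.
+-trace⁻ : ∀ α → IsTrace (E + F) α →
           IsTrace E (lefts α) × IsTrace F (rights α) × (lefts α ≡ [] ⊎ rights α ≡ [])
+-trace⁻ {E = E} {F = F} α t =
  tˡ , tʳ , one-sided _ _ tˡ tʳ (λ p → ∈-lefts⁻ α p) (λ p → ∈-rights⁻ α p)
  where
  u : IsTrace (E ∥ F) α
  u = record
    { distinct      = IsTrace.distinct t
    ; conflict-free = AllPairs.map (_∘ Sum.within) (IsTrace.conflict-free t)
    ; secured       = IsTrace.secured t
    }
  tˡ : IsTrace E (lefts α)
  tˡ = ∥-traceˡ u
  tʳ : IsTrace F (rights α)
  tʳ = ∥-traceʳ u
  one-sided : ∀ ρ σ → IsTrace E ρ → IsTrace F σ →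
              (∀ {a} → a ∈ˡ ρ → inj₁ a ∈ˡ α) → (∀ {b} → b ∈ˡ σ → inj₂ b ∈ˡ α) →
              ρ ≡ [] ⊎ σ ≡ []
  one-sided []      _       _ _ _ _ = inj₁ refl
  one-sided (_ ∷ _) []      _ _ _ _ = inj₂ refl
  one-sided (a ∷ ρ) (b ∷ σ) r s h k =
    ⊥-elim (no-conflict t (h (here refl)) (k (here refl))
      (Sum.across (fwd (Sum.initial (head-initial r) (head-initial s)))))

+-traceˡ⁺ : ∀ {α} → IsTrace E α → IsTrace (E + F) (map inj₁ α)
+-traceˡ⁺ {E = E} {F = F} {α} t = record
  { distinct      = IsTrace.distinct u
  ; conflict-free = AllPairsₚ.map⁺ (AllPairs.map (λ { ¬c (Sum.within (inj₁ c)) → ¬c c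
                                                    ; ¬c (Sum.across (fwd ()))
                                                    ; ¬c (Sum.across (bwd ())) })
                                                 (IsTrace.conflict-free t))
  ; secured       = IsTrace.secured u
  }
  where
  u : IsTrace (E ∥ F) (map inj₁ α)
  u = ∥-trace⁺ (subst (IsTrace E) (sym (mapMaybeIsInj₁∘mapInj₁ α)) t)
               (subst (IsTrace F) (sym (mapMaybeIsInj₂∘mapInj₁ α)) empty-trace)

+-traceʳ⁺ : ∀ {α} → IsTrace F α → IsTrace (E + F) (map inj₂ α)
+-traceʳ⁺ {F = F} {E = E} {α} t = record
  { distinct      = IsTrace.distinct u
  ; conflict-free = AllPairsₚ.map⁺ (AllPairs.map (λ { ¬c (Sum.within (inj₂ c)) → ¬c c
                                                    ; ¬c (Sum.across (fwd ()))
                                                    ; ¬c (Sum.across (bwd ())) })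
                                                 (IsTrace.conflict-free t))
  ; secured       = IsTrace.secured u
  }
  where
  u : IsTrace (E ∥ F) (map inj₂ α)
  u = ∥-trace⁺ (subst (IsTrace E) (sym (mapMaybeIsInj₁∘mapInj₂ α)) empty-trace)
               (subst (IsTrace F) (sym (mapMaybeIsInj₂∘mapInj₂ α)) t)

-- A nonempty trace of `E` excludes every event of `F`, so it stays maximal in the sum; the empty
-- trace need not, as `F` may have an initial event. On lists `lefts` inverts `map inj₁` even if `E`
-- has no event that could serve as a default.
inj₁-embedding : Embedding E (E + F)
inj₁-embedding {E = E} {F = F} = record
  { to         = inj₁
  ; unmap      = lefts
  ; unmap-map  = mapMaybeIsInj₁∘mapInj₁
  ; label-to   = λ _ → refl
  ; to-trace   = +-traceˡ⁺
  ; to-maximal = λ ne m → +-traceˡ⁺ (proj₁ m) , maximal ne m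
  }
  where
  maximal : ∀ {α} → α ≢ [] → Maximal E α → ∀ β → IsTrace (E + F) (map inj₁ α ++ β) → β ≡ []
  maximal {α} ne m β t with +-trace⁻ (map inj₁ α ++ β) t
  ... | tˡ , _ , s
    rewrite lefts-++ (map (inj₁ {B = Event F}) α) β | rights-++ (map (inj₁ {B = Event F}) α) β
          | mapMaybeIsInj₁∘mapInj₁ {B = Event F} α | mapMaybeIsInj₂∘mapInj₁ {B = Event F} α
    with s
  ... | inj₁ eq = ⊥-elim (ne (++-conicalˡ α _ eq))
  ... | inj₂ eq = ⊎-[]⁻ β (proj₂ m (lefts β) tˡ) eq

inj₂-embedding : Embedding F (E + F)
inj₂-embedding {F = F} {E = E} = record
  { to         = inj₂
  ; unmap      = rights
  ; unmap-map  = mapMaybeIsInj₂∘mapInj₂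
  ; label-to   = λ _ → refl
  ; to-trace   = +-traceʳ⁺
  ; to-maximal = λ ne m → +-traceʳ⁺ (proj₁ m) , maximal ne m
  }
  where
  maximal : ∀ {α} → α ≢ [] → Maximal F α → ∀ β → IsTrace (E + F) (map inj₂ α ++ β) → β ≡ []
  maximal {α} ne m β t with +-trace⁻ (map inj₂ α ++ β) t
  ... | _ , tʳ , s
    rewrite lefts-++ (map (inj₂ {A = Event E}) α) β | rights-++ (map (inj₂ {A = Event E}) α) β
          | mapMaybeIsInj₁∘mapInj₂ {A = Event E} α | mapMaybeIsInj₂∘mapInj₂ {A = Event E} α
    with s
  ... | inj₁ eq = ⊎-[]⁻ β eq (proj₂ m (rights β) tʳ)
  ... | inj₂ eq = ⊥-elim (ne (++-conicalˡ α _ eq))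

+-maximalˡ⁻ : ∀ {α} → Maximal (E + F) (map inj₁ α) → Maximal E α
+-maximalˡ⁻ {E = E} {F = F} {α} (t , m) =
  subst (IsTrace E) (mapMaybeIsInj₁∘mapInj₁ α) (proj₁ (+-trace⁻ (map inj₁ α) t)) ,
  λ β u → map-[]⁻ inj₁ β (m (map inj₁ β)
    (subst (IsTrace (E + F)) (map-++ inj₁ α β) (+-traceˡ⁺ u)))

+-maximalʳ⁻ : ∀ {α} → Maximal (E + F) (map inj₂ α) → Maximal F α
+-maximalʳ⁻ {E = E} {F = F} {α} (t , m) =
  subst (IsTrace F) (mapMaybeIsInj₂∘mapInj₂ α) (proj₁ (proj₂ (+-trace⁻ (map inj₂ α) t))) ,
  λ β u → map-[]⁻ inj₂ β (m (map inj₂ β)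
    (subst (IsTrace (E + F)) (map-++ inj₂ α β) (+-traceʳ⁺ u)))

data OneSided {n} (E F : ipBES n) : List (⊎Event E F) → Set₁ where
  left  : ∀ {α} → IsTrace E α → OneSided E F (map inj₁ α)
  right : ∀ {α} → IsTrace F α → OneSided E F (map inj₂ α)

one-sided : ∀ {α} → IsTrace (E + F) α → OneSided E F α
one-sided {E = E} {F = F} {α} t with +-trace⁻ α t
... | _  , tʳ , inj₁ eq = subst (OneSided E F) (lefts≡[] α eq) (right tʳ)
... | tˡ , _  , inj₂ eq = subst (OneSided E F) (rights≡[] α eq) (left tˡ)

-- The last event fixes the side of the whole trace. Matching on this view brings the prefix into
-- the form on which `copairing` reduces to one of its two components.
data OneSidedStep {A B : Set} : List (A ⊎ B) → A ⊎ B → Set where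
  left  : ∀ α e → OneSidedStep (map inj₁ α) (inj₁ e)
  right : ∀ α e → OneSidedStep (map inj₂ α) (inj₂ e)

one-sided-step : ∀ {α e} → IsTrace (E + F) (α ∷ʳ e) → OneSidedStep α e
one-sided-step {E = E} {F = F} {α} {e} t with +-trace⁻ (α ∷ʳ e) t
... | _ , _ , s rewrite lefts-++ α (e ∷ []) | rights-++ α (e ∷ []) with e | s
... | inj₁ a | inj₁ eq = ⊥-elim (∷ʳ-nonempty (lefts α) eq)
... | inj₁ a | inj₂ eq =
  subst (λ α → OneSidedStep α (inj₁ a)) (rights≡[] α (++-conicalˡ _ _ eq)) (left (lefts α) a)
... | inj₂ b | inj₁ eq =
  subst (λ α → OneSidedStep α (inj₂ b)) (lefts≡[] α (++-conicalˡ _ _ eq)) (right (rights α) b)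
... | inj₂ b | inj₂ eq = ⊥-elim (∷ʳ-nonempty (rights α) eq)

copairing : Simulation E G → Simulation F G → Simulation (E + F) G
copairing {E = E} {G = G} {F = F} S T = record
  { f        = h
  ; f-trace  = trace ∘ one-sided
  ; f-empty  = trans (h-left []) S.f-empty
  ; f-finite = λ β →
      map (map inj₁) (proj₁ (S.f-finite β)) ++ map (map inj₂) (proj₁ (T.f-finite β)) ,
      λ t eq → finite β (one-sided t) eq
  ; f-step   = λ α e t → step α e t (one-sided-step t)
  ; f-max    = λ α e m → max α e m (one-sided-step (proj₁ m))
  }
  where
  module S = Simulation S
  module T = Simulation T
  h : List (⊎Event E F) → List (Event G)
  -- On a trace one projection is empty, so the concatenation acts as a case distinction without
  -- deciding anything.
  h α = S.f (lefts α) ++ T.f (rights α)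
  h-left : ∀ α → h (map inj₁ α) ≡ S.f α
  h-left α rewrite mapMaybeIsInj₁∘mapInj₁ {B = Event F} α | mapMaybeIsInj₂∘mapInj₁ {B = Event F} α
                 | T.f-empty = ++-identityʳ (S.f α)
  h-right : ∀ α → h (map inj₂ α) ≡ T.f α
  h-right α rewrite mapMaybeIsInj₁∘mapInj₂ {A = Event E} α | mapMaybeIsInj₂∘mapInj₂ {A = Event E} α
                  | S.f-empty = refl
  h-left-∷ʳ : ∀ α e → h (map inj₁ α ∷ʳ inj₁ e) ≡ S.f (α ∷ʳ e)
  h-left-∷ʳ α e = trans (cong h (sym (map-++ inj₁ α (e ∷ [])))) (h-left (α ∷ʳ e))
  h-right-∷ʳ : ∀ α e → h (map inj₂ α ∷ʳ inj₂ e) ≡ T.f (α ∷ʳ e)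
  h-right-∷ʳ α e = trans (cong h (sym (map-++ inj₂ α (e ∷ [])))) (h-right (α ∷ʳ e))
  trace : ∀ {α} → OneSided E F α → IsTrace G (h α)
  trace (left {α} t)  = subst (IsTrace G) (sym (h-left α)) (S.f-trace t)
  trace (right {α} t) = subst (IsTrace G) (sym (h-right α)) (T.f-trace t)
  finite : ∀ β {α} → OneSided E F α → h α ≡ β →
           α ∈ˡ map (map inj₁) (proj₁ (S.f-finite β)) ++ map (map inj₂) (proj₁ (T.f-finite β))
  finite β (left {α} t) eq =
    ∈-++⁺ˡ (∈-map⁺ (map inj₁) (proj₂ (S.f-finite β) t (trans (sym (h-left α)) eq)))
  finite β (right {α} t) eq =
    ∈-++⁺ʳ _ (∈-map⁺ (map inj₂) (proj₂ (T.f-finite β) t (trans (sym (h-right α)) eq)))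
  step : ∀ α e → IsTrace (E + F) (α ∷ʳ e) → OneSidedStep α e →
         (h (α ∷ʳ e) ≡ h α × ⊎label E F e ⊑ᴴ δ)
         ⊎ (∃[ e′ ] ⊎label E F e ⊑ᴴ label G e′ × h (α ∷ʳ e) ≡ h α ∷ʳ e′)
  step _ _ t (left α e) rewrite h-left-∷ʳ α e | h-left α =
    S.f-step α e (subst (IsTrace E) (mapMaybeIsInj₁∘mapInj₁ (α ∷ʳ e)) (proj₁ (+-trace⁻ _
      (subst (IsTrace (E + F)) (sym (map-++ inj₁ α (e ∷ []))) t))))
  step _ _ t (right α e) rewrite h-right-∷ʳ α e | h-right α =
    T.f-step α e (subst (IsTrace F) (mapMaybeIsInj₂∘mapInj₂ (α ∷ʳ e)) (proj₁ (proj₂ (+-trace⁻ _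
      (subst (IsTrace (E + F)) (sym (map-++ inj₂ α (e ∷ []))) t)))))
  max : ∀ α e → Maximal (E + F) (α ∷ʳ e) → OneSidedStep α e →
        (∃[ e′ ] h (α ∷ʳ e) ≡ h α ∷ʳ e′ × ⊎label E F e ⊑ᴴ label G e′)
        × WeaklyMaximal G (h (α ∷ʳ e))
  max _ _ m (left α e) rewrite h-left-∷ʳ α e | h-left α =
    S.f-max α e (+-maximalˡ⁻ (subst (Maximal (E + F)) (sym (map-++ inj₁ α (e ∷ []))) m))
  max _ _ m (right α e) rewrite h-right-∷ʳ α e | h-right α =
    T.f-max α e (+-maximalʳ⁻ (subst (Maximal (E + F)) (sym (map-++ inj₂ α (e ∷ []))) m))

+-monoʳ : Simulation E F → Simulation (G + E) (G + F)
+-monoʳ S = copairing (embedding-simulation inj₁-embedding id-simulation)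
                      (simulation-embedding S inj₂-embedding)

-- Parallel composition

∥-comm : E ∥ F ≅ F ∥ E
∥-comm {E = E} {F = F} = record
  { to             = swap
  ; from           = swap
  ; from∘to        = swap-involutive
  ; to∘from        = swap-involutive
  ; label-to       = λ { (inj₁ _) → refl ; (inj₂ _) → refl }
  ; conflict-to⁻   = conflict E F
  ; conflict-from⁻ = conflict F E
  ; bundle-to⁻     = bundle E F
  ; bundle-from⁻   = bundle F E
  }
  where
  conflict : ∀ (E F : ipBES n) e e′ → ⊎Conflict F E (swap e) (swap e′) → ⊎Conflict E F e e′
  conflict _ _ (inj₁ _) (inj₁ _) (inj₂ c) = inj₁ c
  conflict _ _ (inj₂ _) (inj₂ _) (inj₁ c) = inj₂ c
  conflict _ _ (inj₁ _) (inj₂ _) ()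
  conflict _ _ (inj₂ _) (inj₁ _) ()
  bundle : ∀ (E F : ipBES n) {y} e → ⊎Bundle F E y (swap e) →
           ∃[ x ] ⊎Bundle E F x e × (∀ e′ → x e′ → y (swap e′))
  bundle _ _ (inj₁ _) (right b) = _ , left b  , λ { (inj₁ _) p → p }
  bundle _ _ (inj₂ _) (left b)  = _ , right b , λ { (inj₂ _) p → p }

∥-assoc : E ∥ (F ∥ G) ≅ (E ∥ F) ∥ G
∥-assoc {E = E} {F = F} {G = G} = record
  { to             = assocˡ
  ; from           = assocʳ
  ; from∘to        = λ { (inj₁ _) → refl ; (inj₂ (inj₁ _)) → refl ; (inj₂ (inj₂ _)) → refl }
  ; to∘from        = λ { (inj₁ (inj₁ _)) → refl ; (inj₁ (inj₂ _)) → refl ; (inj₂ _) → refl }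
  ; label-to       = λ { (inj₁ _) → refl ; (inj₂ (inj₁ _)) → refl ; (inj₂ (inj₂ _)) → refl }
  ; conflict-to⁻   = λ where
      (inj₁ _)        (inj₁ _)        (inj₁ (inj₁ c)) → inj₁ c
      (inj₂ (inj₁ _)) (inj₂ (inj₁ _)) (inj₁ (inj₂ c)) → inj₂ (inj₁ c)
      (inj₂ (inj₂ _)) (inj₂ (inj₂ _)) (inj₂ c)        → inj₂ (inj₂ c)
      (inj₁ _)        (inj₂ (inj₁ _)) (inj₁ ())
      (inj₂ (inj₁ _)) (inj₁ _)        (inj₁ ())
  ; conflict-from⁻ = λ where
      (inj₁ (inj₁ _)) (inj₁ (inj₁ _)) (inj₁ c)        → inj₁ (inj₁ c)
      (inj₁ (inj₂ _)) (inj₁ (inj₂ _)) (inj₂ (inj₁ c)) → inj₁ (inj₂ c)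
      (inj₂ _)        (inj₂ _)        (inj₂ (inj₂ c)) → inj₂ c
      (inj₁ (inj₂ _)) (inj₂ _)        (inj₂ ())
      (inj₂ _)        (inj₁ (inj₂ _)) (inj₂ ())
  ; bundle-to⁻     = λ where
      (inj₁ _)        (left (left b))  → _ , left b          , λ { (inj₁ _) p → p ; (inj₂ _) () }
      (inj₂ (inj₁ _)) (left (right b)) → _ , right (left b)  , λ { (inj₂ (inj₁ _)) p → p ; (inj₁ _) () ; (inj₂ (inj₂ _)) () }
      (inj₂ (inj₂ _)) (right b)        → _ , right (right b) , λ { (inj₂ (inj₂ _)) p → p ; (inj₁ _) () ; (inj₂ (inj₁ _)) () }
  ; bundle-from⁻   = λ where
      (inj₁ (inj₁ _)) (left b)          → _ , left (left b)  , λ { (inj₁ (inj₁ _)) p → p ; (inj₁ (inj₂ _)) () ; (inj₂ _) () }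
      (inj₁ (inj₂ _)) (right (left b))  → _ , left (right b) , λ { (inj₁ (inj₂ _)) p → p ; (inj₁ (inj₁ _)) () ; (inj₂ _) () }
      (inj₂ _)        (right (right b)) → _ , right b        , λ { (inj₂ _) p → p ; (inj₁ _) () }
  }

withoutExits : ipBES n → ipBES n
withoutExits E = record
  { Event    = Event E
  ; _↦_      = ipBES._↦_ E
  ; _#_      = ipBES._#_ E
  ; label    = label E
  ; Φ        = λ _ → Lift _ ⊥
  ; #-irrefl = ipBES.#-irrefl E
  ; #-sym    = ipBES.#-sym E
  ; ↦-conf   = ipBES.↦-conf E
  ; Φ-conf   = λ ()
  }

-- Without exit sets there are no links, so the second operand is free from the start. The operands
-- change places because `·-monoʳ` acts on the second one.
∥≅· : E ∥ F ≅ withoutExits F · E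
∥≅· = record
  { to             = swap
  ; from           = swap
  ; from∘to        = swap-involutive
  ; to∘from        = swap-involutive
  ; label-to       = λ { (inj₁ _) → refl ; (inj₂ _) → refl }
  ; conflict-to⁻   = λ where
      (inj₁ _) (inj₁ _) (inj₂ c) → inj₁ c
      (inj₂ _) (inj₂ _) (inj₁ c) → inj₂ c
  ; conflict-from⁻ = λ where
      (inj₁ _) (inj₁ _) (inj₂ c) → inj₁ c
      (inj₂ _) (inj₂ _) (inj₁ c) → inj₂ c
  ; bundle-to⁻     = λ where
      (inj₁ _) (Sequential.within (right b)) → _ , left b  , λ { (inj₁ _) p → p ; (inj₂ _) () }
      (inj₂ _) (Sequential.within (left b))  → _ , right b , λ { (inj₂ _) p → p ; (inj₁ _) () }
      (inj₁ _) (Sequential.link (lift ()) _)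
  ; bundle-from⁻   = λ where
      (inj₁ _) (right b) → _ , Sequential.within (left b)  , λ { (inj₁ _) p → p ; (inj₂ _) () }
      (inj₂ _) (left b)  → _ , Sequential.within (right b) , λ { (inj₂ _) p → p ; (inj₁ _) () }
  }

-- Kleene star

zero-· : IsZero E → F ≅ E · F
zero-· {E = E} {F = F} (¬e , ¬Φ) = record
  { to             = inj₂
  ; from           = from
  ; from∘to        = λ _ → refl
  ; to∘from        = λ { (inj₁ e) → ⊥-elim (¬e e) ; (inj₂ _) → refl }
  ; label-to       = λ _ → refl
  ; conflict-to⁻   = λ { _ _ (inj₂ c) → c }
  ; conflict-from⁻ = λ where
      (inj₁ e) _        _ → ⊥-elim (¬e e)
      (inj₂ _) (inj₁ e) _ → ⊥-elim (¬e e)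
      (inj₂ _) (inj₂ _) c → inj₂ c
  ; bundle-to⁻     = λ where
      _ (Sequential.within (right b)) → _ , b , λ _ p → p
      _ (Sequential.link p _)         → ⊥-elim (¬Φ _ p)
  ; bundle-from⁻   = λ where
      (inj₁ e) _ → ⊥-elim (¬e e)
      (inj₂ _) b → _ , Sequential.within (right b) , λ { (inj₁ e) _ → ⊥-elim (¬e e) ; (inj₂ _) p → p }
  }
  where
  from : Event E ⊎ Event F → Event F
  from (inj₁ e) = ⊥-elim (¬e e)
  from (inj₂ f) = f

-- Copy 0 of `F` is the left summand, copy 0 of `E` the left factor, and the copies from 1 on form
-- the star again with indices lowered by one. The conflicts agree because, under this renaming,
-- `AfterChoice 0` is the set of initial events of `E · limit E F`.
limit-unfold : (E F : ipBES n) → limit E F ≅ F + E · limit E F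
limit-unfold E F = record
  { to             = to
  ; from           = from
  ; from∘to        = λ { (zero , inj₁ _) → refl ; (zero , inj₂ _) → refl ; (suc _ , _) → refl }
  ; to∘from        = λ { (inj₁ _) → refl ; (inj₂ (inj₁ _)) → refl ; (inj₂ (inj₂ _)) → refl }
  ; label-to       = λ { (zero , inj₁ _) → refl ; (zero , inj₂ _) → refl ; (suc _ , _) → refl }
  ; conflict-to⁻   = conflict-to⁻
  ; conflict-from⁻ = conflict-from⁻
  ; bundle-to⁻     = bundle-to⁻
  ; bundle-from⁻   = bundle-from⁻
  }
  where
  open Limit E F
  L R : ipBES _
  L = limit E F
  R = F + E · L

  to : Copies → Event R
  to (zero  , inj₁ e) = inj₂ (inj₁ e)
  to (zero  , inj₂ f) = inj₁ f
  to (suc k , a)      = inj₂ (inj₂ (k , a))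

  from : Event R → Copies
  from (inj₁ f)              = zero , inj₂ f
  from (inj₂ (inj₁ e))       = zero , inj₁ e
  from (inj₂ (inj₂ (k , a))) = suc k , a

  initial⁻ : ∀ {k a} → (k , a) ∈ Initial L → a ∈ ⊎Initial E F
  initial⁻ {a = inj₁ _} i x b = i _ (copy (left b))
  initial⁻ {a = inj₂ _} i x b = i _ (copy (right b))

  initial-zero : ∀ {a} → a ∈ ⊎Initial E F → (zero , a) ∈ Initial L
  initial-zero i _ (copy (left b))  = i _ b
  initial-zero i _ (copy (right b)) = i _ b

  initial⁺ : ∀ {k a} → Empty (Φ E) → a ∈ ⊎Initial E F → (k , a) ∈ Initial L
  initial⁺ ¬Φ i _ (copy (left b))  = i _ b
  initial⁺ ¬Φ i _ (copy (right b)) = i _ b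
  initial⁺ ¬Φ i _ (link p _)       = ¬Φ _ p

  bundle-to⁻ : ∀ {y} c → ipBES._↦_ R y (to c) → ∃[ x ] Bundle x c × (∀ c′ → x c′ → y (to c′))
  bundle-to⁻ (zero , inj₁ _) (right (Sequential.within (left b))) =
    _ , copy (left b) , λ { (_ , inj₁ _) (refl , p) → p }
  bundle-to⁻ (zero , inj₂ _) (left b) =
    _ , copy (right b) , λ { (_ , inj₂ _) (refl , p) → p }
  bundle-to⁻ (suc _ , _) (right (Sequential.within (right (copy b)))) =
    _ , copy b , λ { (suc _ , _) (refl , p) → refl , p }
  bundle-to⁻ (suc _ , _) (right (Sequential.within (right (link p i)))) =
    _ , link p i , λ { (suc _ , _) (refl , q) → refl , q }
  bundle-to⁻ (suc zero , _) (right (Sequential.link p i)) =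
    _ , link p (initial⁻ i) , λ { (_ , inj₁ _) (refl , q) → q }
  -- The outer `·` links into initial events of the star only, and the exit set behind `p` already
  -- links into this later copy inside the star.
  bundle-to⁻ (suc (suc _) , _) (right (Sequential.link p i)) =
    ⊥-elim (i _ (link p (initial⁻ i)))

  bundle-from⁻ : ∀ {x} c → Bundle x (from c) → ∃[ y ] ipBES._↦_ R y c × (∀ c′ → y c′ → x (from c′))
  bundle-from⁻ (inj₁ _) (copy (right b)) =
    _ , left b , λ { (inj₁ _) p → refl , p }
  bundle-from⁻ (inj₂ (inj₁ _)) (copy (left b)) =
    _ , right (Sequential.within (left b)) , λ { (inj₂ (inj₁ _)) p → refl , p }
  bundle-from⁻ (inj₂ (inj₂ (k , _))) (copy b) =
    _ , right (Sequential.within (right (copy b))) , λ { (inj₂ (inj₂ _)) (refl , p) → refl , p }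
  bundle-from⁻ (inj₂ (inj₂ (zero , _))) (link p i) =
    _ , right (Sequential.link p (initial-zero i)) , λ { (inj₂ (inj₁ _)) q → refl , q }
  bundle-from⁻ (inj₂ (inj₂ (suc _ , _))) (link p i) =
    _ , right (Sequential.within (right (link p i))) , λ { (inj₂ (inj₂ _)) (refl , q) → refl , q }

  Cross-suc : ∀ {k j a b} → Cross (k , a) (j , b) → Cross (suc k , a) (suc j , b)
  Cross-suc (initial i (here j))         = initial i (here j)
  Cross-suc (initial i (later ¬Φ k<j j)) = initial i (later ¬Φ (s≤s k<j) j)
  Cross-suc (exit k≢j p q x y)           = exit (λ { refl → k≢j refl }) p q x y

  Cross-pred : ∀ {k j a b} → Cross (suc k , a) (suc j , b) → Cross (k , a) (j , b)
  Cross-pred (initial i (here j))         = initial i (here j)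
  Cross-pred (initial i (later ¬Φ k<j j)) = initial i (later ¬Φ (s≤s⁻¹ k<j) j)
  Cross-pred (exit k≢j p q x y)           = exit (k≢j ∘ cong suc) p q x y

  Conflict-suc : ∀ {k j a b} → Conflict (k , a) (j , b) → Conflict (suc k , a) (suc j , b)
  Conflict-suc (copy c)         = copy c
  Conflict-suc (across (fwd c)) = across (fwd (Cross-suc c))
  Conflict-suc (across (bwd c)) = across (bwd (Cross-suc c))

  Conflict-pred : ∀ {k j a b} → Conflict (suc k , a) (suc j , b) → Conflict (k , a) (j , b)
  Conflict-pred (copy c)         = copy c
  Conflict-pred (across (fwd c)) = across (fwd (Cross-pred c))
  Conflict-pred (across (bwd c)) = across (bwd (Cross-pred c))

  Cross-to⁻ : ∀ {f} c → Sum.Cross F (E · L) (inj₁ f) (to c) → Cross (zero , inj₂ f) c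
  Cross-to⁻ (zero , inj₁ _) (Sum.initial i j) =
    initial i (here λ x b → j _ (Sequential.within (left b)))
  -- This event of the star is initial in `E · L`, yet any exit set of `E` would link into it; so
  -- `Φ E` is empty, as `later` requires.
  Cross-to⁻ (suc _ , _) (Sum.initial i j) =
    initial i (later (λ x p → j _ (Sequential.link p λ y b → j _ (Sequential.within (right b))))
                     (s≤s z≤n) (initial⁻ λ y b → j _ (Sequential.within (right b))))
  Cross-to⁻ (suc _ , inj₂ _) (Sum.exit p (Sequential.right (unions _ q)) x y) =
    exit (λ ()) p (q _) x y
  -- An exit set of `E · L` coming from `E` presupposes that `L` is zero, but `L` contains a copy of
  -- `e`.
  Cross-to⁻ (zero , inj₁ e) (Sum.exit p (Sequential.zeroʳ (¬c , _) _) x y) =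
    ⊥-elim (¬c (zero , inj₁ e))

  Cross-from⁻ : ∀ {f} c → Cross (zero , inj₂ f) (from (inj₂ c)) → Sum.Cross F (E · L) (inj₁ f) (inj₂ c)
  Cross-from⁻ (inj₁ _) (initial i (here j)) =
    Sum.initial i λ { _ (Sequential.within (left b)) → j _ b }
  Cross-from⁻ (inj₂ _) (initial i (later ¬Φ _ j)) =
    Sum.initial i λ { _ (Sequential.within (right b)) → initial⁺ ¬Φ j _ b
                    ; _ (Sequential.link p _)         → ¬Φ _ p }
  -- An exit set of the star takes one exit set of `F` in every copy; the only one of interest is
  -- repeated in all of them.
  Cross-from⁻ (inj₂ (_ , inj₂ _)) (exit _ p q x y) =
    Sum.exit p (Sequential.right (unions _ (const q))) x y

  conflict-to⁻ : ∀ c d → ipBES._#_ R (to c) (to d) → Conflict c d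
  conflict-to⁻ (zero , inj₂ _) (zero , inj₂ _) (Sum.within (inj₁ c)) = copy (inj₂ c)
  conflict-to⁻ (zero , inj₂ _) d@(zero , inj₁ _) (Sum.across (fwd c)) = across (fwd (Cross-to⁻ d c))
  conflict-to⁻ (zero , inj₂ _) d@(suc _ , _) (Sum.across (fwd c)) = across (fwd (Cross-to⁻ d c))
  conflict-to⁻ d@(zero , inj₁ _) (zero , inj₂ _) (Sum.across (bwd c)) = across (bwd (Cross-to⁻ d c))
  conflict-to⁻ d@(suc _ , _) (zero , inj₂ _) (Sum.across (bwd c)) = across (bwd (Cross-to⁻ d c))
  conflict-to⁻ (zero , inj₁ _) (zero , inj₁ _) (Sum.within (inj₂ (inj₁ c))) = copy (inj₁ c)
  conflict-to⁻ (suc _ , _) (suc _ , _) (Sum.within (inj₂ (inj₂ c))) = Conflict-suc c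
  conflict-to⁻ (zero , inj₂ _) (zero , inj₂ _) (Sum.across (fwd ()))
  conflict-to⁻ (zero , inj₂ _) (zero , inj₂ _) (Sum.across (bwd ()))
  conflict-to⁻ (zero , inj₁ _) (zero , inj₁ _) (Sum.across (fwd ()))
  conflict-to⁻ (zero , inj₁ _) (zero , inj₁ _) (Sum.across (bwd ()))
  conflict-to⁻ (zero , inj₁ _) (suc _ , _) (Sum.within (inj₂ ()))
  conflict-to⁻ (zero , inj₁ _) (suc _ , _) (Sum.across (fwd ()))
  conflict-to⁻ (zero , inj₁ _) (suc _ , _) (Sum.across (bwd ()))
  conflict-to⁻ (suc _ , _) (zero , inj₁ _) (Sum.within (inj₂ ()))
  conflict-to⁻ (suc _ , _) (zero , inj₁ _) (Sum.across (fwd ()))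
  conflict-to⁻ (suc _ , _) (zero , inj₁ _) (Sum.across (bwd ()))
  conflict-to⁻ (suc _ , _) (zero , inj₂ _) (Sum.within ())
  conflict-to⁻ (suc _ , _) (suc _ , _) (Sum.across (fwd ()))
  conflict-to⁻ (suc _ , _) (suc _ , _) (Sum.across (bwd ()))

  conflict-zero⁻ : ∀ {f} c → Conflict (zero , inj₂ f) (from (inj₂ c)) → Sum.Cross F (E · L) (inj₁ f) (inj₂ c)
  conflict-zero⁻ c@(inj₁ _) (across (fwd x)) = Cross-from⁻ c x
  conflict-zero⁻ c@(inj₂ _) (across (fwd x)) = Cross-from⁻ c x
  conflict-zero⁻ (inj₂ (_ , inj₂ _)) (across (bwd (exit k≢j p q x y))) =
    Cross-from⁻ _ (exit (k≢j ∘ sym) q p y x)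
  conflict-zero⁻ (inj₂ _) (across (bwd (initial _ (later _ () _))))
  conflict-zero⁻ (inj₁ _) (copy ())
  conflict-zero⁻ (inj₁ _) (across (bwd ()))

  conflict-from⁻ : ∀ c d → Conflict (from c) (from d) → ipBES._#_ R c d
  conflict-from⁻ (inj₁ _) (inj₁ _) (copy (inj₂ c)) = Sum.within (inj₁ c)
  conflict-from⁻ (inj₁ _) (inj₁ _) (across (fwd (exit k≢k _ _ _ _))) = ⊥-elim (k≢k refl)
  conflict-from⁻ (inj₁ _) (inj₁ _) (across (bwd (exit k≢k _ _ _ _))) = ⊥-elim (k≢k refl)
  conflict-from⁻ (inj₁ _) (inj₁ _) (across (fwd (initial _ (later _ () _))))
  conflict-from⁻ (inj₁ _) (inj₁ _) (across (bwd (initial _ (later _ () _))))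
  conflict-from⁻ (inj₁ _) (inj₂ d) c = Sum.across (fwd (conflict-zero⁻ d c))
  conflict-from⁻ (inj₂ d) (inj₁ _) c = Sum.across (bwd (conflict-zero⁻ d (symm c)))
  conflict-from⁻ (inj₂ (inj₁ _)) (inj₂ (inj₁ _)) (copy (inj₁ c)) = Sum.within (inj₂ (inj₁ c))
  conflict-from⁻ (inj₂ (inj₂ _)) (inj₂ (inj₂ _)) c = Sum.within (inj₂ (inj₂ (Conflict-pred c)))
  conflict-from⁻ (inj₂ (inj₁ _)) (inj₂ (inj₁ _)) (across (fwd ()))
  conflict-from⁻ (inj₂ (inj₁ _)) (inj₂ (inj₁ _)) (across (bwd ()))
  conflict-from⁻ (inj₂ (inj₁ _)) (inj₂ (inj₂ _)) (across (fwd ()))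
  conflict-from⁻ (inj₂ (inj₁ _)) (inj₂ (inj₂ _)) (across (bwd (initial _ (later _ () _))))
  conflict-from⁻ (inj₂ (inj₂ _)) (inj₂ (inj₁ _)) (across (fwd (initial _ (later _ () _))))
  conflict-from⁻ (inj₂ (inj₂ _)) (inj₂ (inj₁ _)) (across (bwd ()))

*-unfold : (em : ExcludedMiddle 1ℓ) (E F : ipBES n) → E *[ em ] F ≡sim F + E · (E *[ em ] F)
*-unfold em E F with em {IsZero E}
... | no  _ = ≅⇒≡sim (limit-unfold E F)
-- The star is `F` here, and `zero-·` makes `E · F` a second copy of it; the simulation back sends
-- both copies to `F`.
... | yes z =
  embedding⇒⊑ inj₁-embedding ,
  fromSimulation (copairing id-simulation
    (embedding-simulation (≅⇒embedding (≅-sym (zero-· z))) id-simulation))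

-- Sequential composition

module _ {A B : Set} (α : List (A ⊎ B)) where
  lefts-++-inj₁ : ∀ β → lefts (α ++ map inj₁ β) ≡ lefts α ++ β
  lefts-++-inj₁ β = trans (lefts-++ α _) (cong (lefts α ++_) (mapMaybeIsInj₁∘mapInj₁ β))

  lefts-++-inj₂ : ∀ β → lefts (α ++ map inj₂ β) ≡ lefts α
  lefts-++-inj₂ β =
    trans (lefts-++ α _) (trans (cong (lefts α ++_) (mapMaybeIsInj₁∘mapInj₂ β)) (++-identityʳ _))

  rights-++-inj₁ : ∀ β → rights (α ++ map inj₁ β) ≡ rights α
  rights-++-inj₁ β =
    trans (rights-++ α _) (trans (cong (rights α ++_) (mapMaybeIsInj₂∘mapInj₁ β)) (++-identityʳ _))

  rights-++-inj₂ : ∀ β → rights (α ++ map inj₂ β) ≡ rights α ++ β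
  rights-++-inj₂ β = trans (rights-++ α _) (cong (rights α ++_) (mapMaybeIsInj₂∘mapInj₂ β))

module _ {n} (G : ipBES n) where
  Exited : List (Event G) → Set₁
  Exited ρ = ∀ x → x ∈ Φ G → Any x ρ

  -- The links of G · E only constrain the first event of E, since that one is initial.
  Guarded : {B : Set} → List (Event G) → List (Event G ⊎ B) → Set₁
  Guarded ρ []           = ⊤
  Guarded ρ (inj₁ g ∷ α) = Guarded (ρ ∷ʳ g) α
  Guarded ρ (inj₂ b ∷ α) = Exited ρ

  exited-++ : ∀ {ρ} σ → Exited ρ → Exited (ρ ++ σ)
  exited-++ σ h x p = Anyₚ.++⁺ˡ (h x p)

module _ {n} {G : ipBES n} {B : Set} where
  -- Checking the first event of `B` is enough, hence `rights β ≡ []`: in a trace of `G · E` this is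
  -- the event known to be initial in `E`. Since exits persist, `guarded⁻` recovers the condition
  -- for every event of `B`.
  guarded⁺ : ∀ ρ (α : List (Event G ⊎ B)) →
             (∀ β b γ → α ≡ β ++ inj₂ b ∷ γ → rights β ≡ [] → Exited G (ρ ++ lefts β)) →
             Guarded G ρ α
  guarded⁺ ρ []           h = tt
  guarded⁺ ρ (inj₁ g ∷ α) h = guarded⁺ (ρ ∷ʳ g) α λ β b γ eq r →
    subst (Exited G) (sym (∷ʳ-++ ρ g (lefts β))) (h (inj₁ g ∷ β) b γ (cong (inj₁ g ∷_) eq) r)
  guarded⁺ ρ (inj₂ b ∷ α) h = subst (Exited G) (++-identityʳ ρ) (h [] b α refl refl)

  guarded⁻ : ∀ ρ (β : List (Event G ⊎ B)) b γ → Guarded G ρ (β ++ inj₂ b ∷ γ) → Exited G (ρ ++ lefts β)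
  guarded⁻ ρ []           b γ h = subst (Exited G) (sym (++-identityʳ ρ)) h
  guarded⁻ ρ (inj₁ g ∷ β) b γ h = subst (Exited G) (∷ʳ-++ ρ g (lefts β)) (guarded⁻ (ρ ∷ʳ g) β b γ h)
  guarded⁻ ρ (inj₂ _ ∷ β) b γ h = exited-++ G (lefts β) h

  guarded-exited : ∀ ρ (α : List (Event G ⊎ B)) → Exited G ρ → Guarded G ρ α
  guarded-exited ρ []           h = tt
  guarded-exited ρ (inj₁ g ∷ α) h = guarded-exited (ρ ∷ʳ g) α (exited-++ G (g ∷ []) h)
  guarded-exited ρ (inj₂ b ∷ α) h = h

  guarded-inj₁ : ∀ ρ α → Guarded G {B} ρ (map inj₁ α)
  guarded-inj₁ ρ []      = tt
  guarded-inj₁ ρ (g ∷ α) = guarded-inj₁ (ρ ∷ʳ g) α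

  guarded-++ : ∀ ρ (α β : List (Event G ⊎ B)) →
               Guarded G ρ α → Guarded G (ρ ++ lefts α) β → Guarded G ρ (α ++ β)
  guarded-++ ρ []           β h k = subst (λ ρ → Guarded G ρ β) (++-identityʳ ρ) k
  guarded-++ ρ (inj₁ g ∷ α) β h k =
    guarded-++ (ρ ∷ʳ g) α β h (subst (λ ρ → Guarded G ρ β) (sym (∷ʳ-++ ρ g (lefts α))) k)
  guarded-++ ρ (inj₂ b ∷ α) β h k = h

  -- The first event of `B`, if there is one, certifies the exit, which further events cannot undo.
  guarded-cases : ∀ ρ (α : List (Event G ⊎ B)) → Guarded G ρ α → Exited G (ρ ++ lefts α) ⊎ rights α ≡ []
  guarded-cases ρ []           h = inj₂ refl
  guarded-cases ρ (inj₁ g ∷ α) h =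
    subst (λ ρ → Exited G ρ ⊎ rights α ≡ []) (∷ʳ-++ ρ g (lefts α)) (guarded-cases (ρ ∷ʳ g) α h)
  guarded-cases ρ (inj₂ b ∷ α) h = inj₁ (exited-++ G (lefts α) h)

·-trace⁺ : ∀ {α} → IsTrace G (lefts α) → IsTrace E (rights α) → Guarded G [] α → IsTrace (G · E) α
·-trace⁺ {G = G} {E = E} {α} s t g = record
  { distinct      = IsTrace.distinct u
  ; conflict-free = IsTrace.conflict-free u
  ; secured       = secured
  }
  where
  u : IsTrace (G ∥ E) α
  u = ∥-trace⁺ s t
  secured : Secured (Sequential.Bundle G E) α
  secured β e γ eq x (Sequential.within b) = IsTrace.secured u β e γ eq x b
  secured β (inj₂ e) γ refl _ (Sequential.link p _) =
    Any-lefts⁻ id β (guarded⁻ {G = G} [] β e γ g _ p)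

·-trace⁻ : ∀ α → IsTrace (G · E) α → IsTrace G (lefts α) × IsTrace E (rights α) × Guarded G [] α
·-trace⁻ {G = G} {E = E} α t = ∥-traceˡ u , ∥-traceʳ u , guarded⁺ [] α first
  where
  u : IsTrace (G ∥ E) α
  u = record
    { distinct      = IsTrace.distinct t
    ; conflict-free = IsTrace.conflict-free t
    ; secured       = λ β e γ eq x b → IsTrace.secured t β e γ eq x (Sequential.within b)
    }
  first : ∀ β b γ → α ≡ β ++ inj₂ b ∷ γ → rights β ≡ [] → Exited G (lefts β)
  -- With `rights β` empty, `b` heads the `E`-part of the trace and is therefore initial in `E`, so
  -- each exit set of `G` links into it.
  first β b γ eq none x p = Any-lefts⁺ id id
    (IsTrace.secured t β (inj₂ b) γ eq _ (Sequential.link p (head-initial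
      (subst (IsTrace E)
        (trans (cong rights eq) (trans (rights-++ β _) (cong (_++ b ∷ rights γ) none)))
        (∥-traceʳ u)))))

LeftMaximal : (G : ipBES n) → List (Event G ⊎ B) → Set₁
LeftMaximal G α = ∀ β → IsTrace G (lefts α ++ β) → β ≡ []

-- No bundle or conflict leads from `E` to `G`, so `G` may move at any time, even between or after
-- events of `E`.
·-maximalˡ⁻ : ∀ {α} → Maximal (G · E) α → LeftMaximal G α
·-maximalˡ⁻ {G = G} {E = E} {α} (t , m) β u with ·-trace⁻ α t
... | _ , tʳ , g = map-[]⁻ inj₁ β (m (map inj₁ β) (·-trace⁺
  (subst (IsTrace G) (sym (lefts-++-inj₁ α β)) u)
  (subst (IsTrace E) (sym (rights-++-inj₁ α β)) tʳ)
  (guarded-++ [] α (map inj₁ β) g (guarded-inj₁ (lefts α) β))))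

·-maximalʳ⁻ : ∀ {α} → Maximal (G · E) α → Exited G (lefts α) → Maximal E (rights α)
·-maximalʳ⁻ {G = G} {E = E} {α} (t , m) x with ·-trace⁻ α t
... | tˡ , tʳ , g = tʳ , λ β u → map-[]⁻ inj₂ β (m (map inj₂ β) (·-trace⁺
  (subst (IsTrace G) (sym (lefts-++-inj₂ α β)) tˡ)
  (subst (IsTrace E) (sym (rights-++-inj₂ α β)) u)
  (guarded-++ [] α (map inj₂ β) g (guarded-exited (lefts α) (map inj₂ β) x))))

·-maximal⁺ : ∀ {α} es → IsTrace (G · E) α → LeftMaximal G α → Exited G (lefts α) →
             Maximal E (rights α ++ es) → Maximal (G · E) (α ++ map inj₂ es)
·-maximal⁺ {G = G} {E = E} {α} es t l x (u , m) with ·-trace⁻ α t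
... | tˡ , _ , g = ·-trace⁺
    (subst (IsTrace G) (sym (lefts-++-inj₂ α es)) tˡ)
    (subst (IsTrace E) (sym (rights-++-inj₂ α es)) u)
    (guarded-++ [] α (map inj₂ es) g (guarded-exited (lefts α) (map inj₂ es) x)) ,
  maximal
  where
  maximal : ∀ β → IsTrace (G · E) ((α ++ map inj₂ es) ++ β) → β ≡ []
  maximal β v with ·-trace⁻ ((α ++ map inj₂ es) ++ β) v
  ... | vˡ , vʳ , _ = ⊎-[]⁻ β
    (l (lefts β) (subst (IsTrace G)
      (trans (lefts-++ (α ++ map inj₂ es) β) (cong (_++ lefts β) (lefts-++-inj₂ α es))) vˡ))
    (m (rights β) (subst (IsTrace E)
      (trans (rights-++ (α ++ map inj₂ es) β) (cong (_++ rights β) (rights-++-inj₂ α es))) vʳ))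

-- Without an exit no event of `E` can occur, and as `G` cannot move either, an exit will never
-- come.
·-maximal-unexited⁺ : ∀ {α} → IsTrace (G · E) α → LeftMaximal G α → ¬ Exited G (lefts α) →
                      Maximal (G · E) α
·-maximal-unexited⁺ {G = G} {E = E} {α} t l ¬x = t , maximal
  where
  maximal : ∀ β → IsTrace (G · E) (α ++ β) → β ≡ []
  maximal β v with ·-trace⁻ (α ++ β) v
  ... | vˡ , vʳ , g
    with guarded-cases [] (α ++ β) g
       | l (lefts β) (subst (IsTrace G) (lefts-++ α β) vˡ)
  ... | inj₂ eq | none = ⊎-[]⁻ β none (++-conicalʳ (rights α) _ (trans (sym (rights-++ α β)) eq))
  ... | inj₁ x  | none = ⊥-elim (¬x (subst (Exited G)
    (trans (lefts-++ α β) (trans (cong (lefts α ++_) none) (++-identityʳ _))) x))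

-- Transport of a simulation along the interleavings in `G · E`

module _ {n} {E F : ipBES n} (G : ipBES n) (S : Simulation E F) where
  private module S = Simulation S

  -- By `f-step` this is empty or a single event whenever `ρ ∷ʳ e` is a trace; `drop` reads it off
  -- without deciding which case holds.
  increment : List (Event E) → Event E → List (Event F)
  increment ρ e = drop (length (S.f ρ)) (S.f (ρ ∷ʳ e))

  increment≡ : ∀ {ρ e Δ} → S.f (ρ ∷ʳ e) ≡ S.f ρ ++ Δ → increment ρ e ≡ Δ
  increment≡ {ρ} {Δ = Δ} eq = trans (cong (drop (length (S.f ρ))) eq) (drop-length-++ (S.f ρ) Δ)

  f-increment : ∀ ρ e → IsTrace E (ρ ∷ʳ e) → S.f (ρ ∷ʳ e) ≡ S.f ρ ++ increment ρ e
  f-increment ρ e t with S.f-step ρ e t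
  ... | inj₁ (eq , _)     = trans eq′ (cong (S.f ρ ++_) (sym (increment≡ eq′)))
    where
    eq′ : S.f (ρ ∷ʳ e) ≡ S.f ρ ++ []
    eq′ = trans eq (sym (++-identityʳ _))
  ... | inj₂ (_ , _ , eq) = trans eq (cong (S.f ρ ++_) (sym (increment≡ eq)))

  -- ρ is the sequence of events of E seen so far.
  interleave : List (Event E) → List (⊎Event G E) → List (⊎Event G F)
  interleave ρ []           = []
  interleave ρ (inj₁ g ∷ α) = inj₁ g ∷ interleave ρ α
  interleave ρ (inj₂ e ∷ α) = map inj₂ (increment ρ e) ++ interleave (ρ ∷ʳ e) α

  interleave-++ : ∀ ρ α β → interleave ρ (α ++ β) ≡ interleave ρ α ++ interleave (ρ ++ rights α) β
  interleave-++ ρ []           β = cong (λ ρ → interleave ρ β) (sym (++-identityʳ ρ))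
  interleave-++ ρ (inj₁ g ∷ α) β = cong (inj₁ g ∷_) (interleave-++ ρ α β)
  interleave-++ ρ (inj₂ e ∷ α) β =
    trans (cong (map inj₂ (increment ρ e) ++_)
             (trans (interleave-++ (ρ ∷ʳ e) α β)
                    (cong (λ σ → interleave (ρ ∷ʳ e) α ++ interleave σ β) (∷ʳ-++ ρ e (rights α)))))
          (sym (++-assoc (map inj₂ (increment ρ e)) _ _))

  lefts-interleave : ∀ ρ α → lefts (interleave ρ α) ≡ lefts α
  lefts-interleave ρ []           = refl
  lefts-interleave ρ (inj₁ g ∷ α) = cong (g ∷_) (lefts-interleave ρ α)
  lefts-interleave ρ (inj₂ e ∷ α) =
    trans (lefts-++ (map inj₂ (increment ρ e)) _)
          (trans (cong (_++ lefts (interleave (ρ ∷ʳ e) α)) (mapMaybeIsInj₁∘mapInj₂ (increment ρ e)))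
                 (lefts-interleave (ρ ∷ʳ e) α))

  -- The increments telescope: each one prolongs the image of the events seen so far to the image
  -- with one event more.
  rights-interleave : ∀ ρ α → IsTrace E (ρ ++ rights α) →
                      S.f ρ ++ rights (interleave ρ α) ≡ S.f (ρ ++ rights α)
  rights-interleave ρ []           t = trans (++-identityʳ _) (cong S.f (sym (++-identityʳ ρ)))
  rights-interleave ρ (inj₁ g ∷ α) t = rights-interleave ρ α t
  rights-interleave ρ (inj₂ e ∷ α) t =
    trans (cong (S.f ρ ++_) (trans (rights-++ (map inj₂ (increment ρ e)) _)
                                   (cong (_++ rights (interleave (ρ ∷ʳ e) α)) (mapMaybeIsInj₂∘mapInj₂ (increment ρ e)))))
    (trans (sym (++-assoc (S.f ρ) _ _))
    (trans (cong (_++ rights (interleave (ρ ∷ʳ e) α)) (sym (f-increment ρ e (trace-prefix (ρ ∷ʳ e) t′))))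
    (trans (rights-interleave (ρ ∷ʳ e) α t′) (cong S.f (∷ʳ-++ ρ e (rights α))))))
    where
    t′ : IsTrace E ((ρ ∷ʳ e) ++ rights α)
    t′ = subst (IsTrace E) (sym (∷ʳ-++ ρ e (rights α))) t

  -- Up to the first event of `E` the two interleavings coincide, and from there on the exits have
  -- been made, so no replacement can violate the guard.
  guarded-interleave : ∀ σ ρ α → Guarded G σ α → Guarded G σ (interleave ρ α)
  guarded-interleave σ ρ []           h = tt
  guarded-interleave σ ρ (inj₁ g ∷ α) h = guarded-interleave (σ ∷ʳ g) ρ α h
  guarded-interleave σ ρ (inj₂ e ∷ α) h =
    guarded-exited {G = G} σ (map inj₂ (increment ρ e) ++ interleave (ρ ∷ʳ e) α) h

  replace : List (⊎Event G E) → List (⊎Event G F)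
  replace = interleave []

  rights-replace : ∀ {α} → IsTrace E (rights α) → rights (replace α) ≡ S.f (rights α)
  rights-replace {α} t = trans (cong (_++ rights (replace α)) (sym S.f-empty)) (rights-interleave [] α t)

  replace-trace : ∀ {α} → IsTrace (G · E) α → IsTrace (G · F) (replace α)
  replace-trace {α} t with ·-trace⁻ α t
  ... | tˡ , tʳ , g = ·-trace⁺
    (subst (IsTrace G) (sym (lefts-interleave [] α)) tˡ)
    (subst (IsTrace F) (sym (rights-replace {α} tʳ)) (S.f-trace tʳ))
    (guarded-interleave [] [] α g)

  replace-left : ∀ α g → replace (α ∷ʳ inj₁ g) ≡ replace α ∷ʳ inj₁ g
  replace-left α g = interleave-++ [] α (inj₁ g ∷ [])

  replace-right : ∀ {Δ} α e → S.f (rights α ∷ʳ e) ≡ S.f (rights α) ++ Δ →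
            replace (α ∷ʳ inj₂ e) ≡ replace α ++ map inj₂ Δ
  replace-right α e eq = trans (interleave-++ [] α (inj₂ e ∷ []))
    (cong (replace α ++_) (trans (++-identityʳ _) (cong (map inj₂) (increment≡ eq))))

  -- `f-max` of `S` covers nonempty `E`-parts. A maximal trace of `G · E` may also consist of events
  -- of `G` alone, with `G` exited and `E` unable to start; then `w` says that `F` needs at most
  -- events above `δ`. Excluded middle decides whether `G` has exited.
  ·-monoʳ : ExcludedMiddle 1ℓ → (Maximal E [] → WeaklyMaximal F []) → Simulation (G · E) (G · F)
  ·-monoʳ em w = record
    { f        = replace
    ; f-trace  = replace-trace
    ; f-empty  = refl
    -- A preimage of `β` has the same `G`-part, one of finitely many `E`-parts, and finitely many
    -- ways to shuffle the two.
    ; f-finite = λ β → concatMap (shuffles (lefts β)) (proj₁ (S.f-finite (rights β))) , finite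
    ; f-step   = step
    ; f-max    = λ α e m → last-kept α e m , weakly-maximal m
    }
    where
    finite : ∀ {β α} → IsTrace (G · E) α → replace α ≡ β →
             α ∈ˡ concatMap (shuffles (lefts β)) (proj₁ (S.f-finite (rights β)))
    finite {α = α} t refl with ·-trace⁻ α t
    ... | _ , tʳ , _ = ∈-concatMap⁺ (shuffles (lefts (replace α)))
      (Any.map (λ { refl → subst (λ ρ → α ∈ˡ shuffles ρ (rights α)) (sym (lefts-interleave [] α)) (∈-shuffles α) })
               (proj₂ (S.f-finite (rights (replace α))) tʳ (sym (rights-replace {α} tʳ))))

    rights-trace : ∀ {α e} → IsTrace (G · E) (α ∷ʳ inj₂ e) → IsTrace E (rights α ∷ʳ e)
    rights-trace {α} t = subst (IsTrace E) (rights-++ α _) (proj₁ (proj₂ (·-trace⁻ _ t)))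

    step : ∀ α e → IsTrace (G · E) (α ∷ʳ e) →
           (replace (α ∷ʳ e) ≡ replace α × ⊎label G E e ⊑ᴴ δ)
           ⊎ (∃[ e′ ] ⊎label G E e ⊑ᴴ ⊎label G F e′ × replace (α ∷ʳ e) ≡ replace α ∷ʳ e′)
    step α (inj₁ g) t = inj₂ (inj₁ g , (λ _ p → p) , replace-left α g)
    step α (inj₂ e) t with S.f-step (rights α) e (rights-trace t)
    ... | inj₁ (eq , l)      =
      inj₁ (trans (replace-right α e (trans eq (sym (++-identityʳ _)))) (++-identityʳ _) , l)
    ... | inj₂ (e′ , l , eq) = inj₂ (inj₂ e′ , l , replace-right α e eq)

    last-kept : ∀ α e → Maximal (G · E) (α ∷ʳ e) →
                ∃[ e′ ] replace (α ∷ʳ e) ≡ replace α ∷ʳ e′ × ⊎label G E e ⊑ᴴ ⊎label G F e′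
    last-kept α (inj₁ g) m = inj₁ g , replace-left α g , λ _ p → p
    -- An event of `E` has occurred, so `G` has exited and the `E`-part is maximal; hence `S` may
    -- not drop its last event.
    last-kept α (inj₂ e) m with guarded-cases [] (α ∷ʳ inj₂ e) (proj₂ (proj₂ (·-trace⁻ _ (proj₁ m))))
    ... | inj₂ eq = ⊥-elim (∷ʳ-nonempty (rights α) (trans (sym (rights-++ α _)) eq))
    ... | inj₁ x
      with S.f-max (rights α) e (subst (Maximal E) (rights-++ α _) (·-maximalʳ⁻ m x))
    ... | (e′ , eq , l) , _ = inj₂ e′ , replace-right α e eq , l

    f-weakly-maximal : ∀ {ρ} → Maximal E ρ → WeaklyMaximal F (S.f ρ)
    f-weakly-maximal {ρ} m with initLast ρ
    ... | []      = subst (WeaklyMaximal F) (sym S.f-empty) (w m)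
    ... | ρ ∷ʳ′ e = proj₂ (S.f-max ρ e m)

    left-maximal : ∀ {α} → Maximal (G · E) α → LeftMaximal G (replace α)
    left-maximal {α} m β u =
      ·-maximalˡ⁻ m β (subst (λ ρ → IsTrace G (ρ ++ β)) (lefts-interleave [] α) u)

    weakly-maximal : ∀ {α} → Maximal (G · E) α → WeaklyMaximal (G · F) (replace α)
    -- Unexited, neither side can move and the image is already maximal. Exited, the `E`-part is
    -- maximal, and its image is completed by events of `F` above `δ`, all appended at the end.
    weakly-maximal {α} m with em {Exited G (lefts α)}
    ... | no ¬x = inj₁ (·-maximal-unexited⁺ (replace-trace (proj₁ m)) (left-maximal m)
                    (¬x ∘ subst (Exited G) (lefts-interleave [] α)))
    ... | yes x with weaken-max (f-weakly-maximal (·-maximalʳ⁻ m x))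
    ... | es , m′ , ls = inj₂ (map inj₂ es ,
      ·-maximal⁺ es (replace-trace (proj₁ m)) (left-maximal m)
        (subst (Exited G) (sym (lefts-interleave [] α)) x)
        (subst (λ ρ → Maximal F (ρ ++ es)) (sym (rights-replace {α} (proj₁ (·-maximalʳ⁻ m x)))) m′) ,
      Allₚ.map⁺ ls)

-- The premise on the empty trace excludes the following situation: `E` is zero, `F` and `G` have
-- one event each, `f` and `g`, with labels not above `δ`, and the exit set of `G` is the singleton
-- of `g`. Then `E ⊑sim F` holds trivially, but the maximal trace `g` of `G · E` or `E ∥ G` has to
-- be sent to a single event, after which the other event is still possible; so the image is not
-- weakly maximal.
proposition4p12 : (em : ExcludedMiddle 1ℓ) (n : ℕ) (E F G : ipBES n) →
    (E ∥ F ≡sim F ∥ E)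
    × (E ∥ (F ∥ G) ≡sim (E ∥ F) ∥ G)
    × (E *[ em ] F ≡sim F + E · (E *[ em ] F))
    × (E ⊑sim F → G + E ⊑sim G + F)
    × (E ⊑sim F → (Maximal E [] → WeaklyMaximal F []) → G · E ⊑sim G · F)
    × (E ⊑sim F → (Maximal E [] → WeaklyMaximal F []) → E ∥ G ⊑sim F ∥ G)
proposition4p12 em n E F G =
  ≅⇒≡sim ∥-comm ,
  ≅⇒≡sim ∥-assoc ,
  *-unfold em E F ,
  (λ S → fromSimulation (+-monoʳ (toSimulation em S))) ,
  (λ S w → fromSimulation (·-monoʳ G (toSimulation em S) em w)) ,
  (λ S w → fromSimulation
    (embedding-simulation (≅⇒embedding ∥≅·)
      (simulation-embedding (·-monoʳ (withoutExits G) (toSimulation em S) em w)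
        (≅⇒embedding (≅-sym ∥≅·)))))
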